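{- Let $T(n)$ be the total number of toothpicks in the toothpick structure after $n$ stages. For all $n\ge1$, $$ \frac{T(n)}{n^2}\le \frac23+\frac{1}{3n}, $$ with equality if and only if $n=2^k-1$ for some integer $k$. Hence $\limsup_{n\to\infty} T(n)/n^2=2/3$.
   Context: A toothpick is a line segment of length $1$ in the plane. The toothpick structure: at stage $1$ place a single toothpick on the $y$-axis centered at the origin; an end of a toothpick is exposed if that point is neither an end nor the midpoint of any other toothpick; at each subsequent stage, for every exposed toothpick end, place a toothpick centered at that end and perpendicular to the toothpick having that end. $T(0)=0$. -}

module Defs where

open import Data.Bool using (Bool; true; false; _∧_; not; if_then_else_)
open import Data.Nat as ℕ using (ℕ; zero; suc; _≤_)
open import Data.Integer as ℤ using (ℤ; +_; _+_; _-_)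
open import Data.Product using (_×_; _,_; Σ; ∃)
open import Data.List using (List; []; _∷_; _++_; length; filter; map; concatMap)
open import Relation.Nullary using (does)
open import Relation.Nullary.Decidable using (⌊_⌋)
open import Data.Rational as ℚ using (ℚ; _/_)

-- Coordinates are DOUBLED so that all relevant points are integral:
-- a toothpick of length 1 has, in doubled coordinates, length 2,
-- center c and endpoints c ± (0,1) (vertical) or c ± (1,0) (horizontal).
Point : Set
Point = ℤ × ℤ

data Orient : Set where
  vert horiz : Orient

perp : Orient → Orient
perp vert  = horiz
perp horiz = vert

record Toothpick : Set where
  constructor tp
  field
    center : Point
    orient : Orient
open Toothpick public

_==ℤ_ : ℤ → ℤ → Bool
a ==ℤ b = ⌊ a ℤ.≟ b ⌋

_==P_ : Point → Point → Bool
(a , b) ==P (c , d) = (a ==ℤ c) ∧ (b ==ℤ d)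

_==O_ : Orient → Orient → Bool
vert  ==O vert  = true
horiz ==O horiz = true
_     ==O _     = false

_==T_ : Toothpick → Toothpick → Bool
tp c o ==T tp c' o' = (c ==P c') ∧ (o ==O o')

ends : Toothpick → List Point
ends (tp (x , y) vert)  = (x , y + + 1) ∷ (x , y - + 1) ∷ []
ends (tp (x , y) horiz) = (x + + 1 , y) ∷ (x - + 1 , y) ∷ []

elemP : Point → List Point → Bool
elemP p []       = false
elemP p (q ∷ qs) = (p ==P q) Data.Bool.∨ elemP p qs

touches : Point → Toothpick → Bool
touches p q = elemP p (ends q) Data.Bool.∨ (p ==P center q)

allL : {A : Set} → (A → Bool) → List A → Bool
allL f []       = true
allL f (x ∷ xs) = f x ∧ allL f xs

exposed : List Toothpick → Toothpick → Point → Bool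
exposed S t e = allL (λ q → (q ==T t) Data.Bool.∨ not (touches e q)) S

newPicks : List Toothpick → List Toothpick
newPicks S = concatMap (λ t → map (λ e → tp e (perp (orient t)))
                                  (filter (λ e → exposed S t e Data.Bool.≟ true) (ends t))) S

step : List Toothpick → List Toothpick
step S = S ++ newPicks S

structure : ℕ → List Toothpick
structure zero          = []
structure (suc zero)    = tp (+ 0 , + 0) vert ∷ []
structure (suc (suc n)) = step (structure (suc n))

T : ℕ → ℕ
T n = length (structure n)

ratio : ℕ → ℚ
ratio zero    = ℚ.0ℚ
ratio (suc m) = (+ T (suc m)) / (suc m ℕ.* suc m)

LimsupEq : (ℕ → ℚ) → ℚ → Set
LimsupEq r L = ∀ (ε : ℚ) → ℚ.Positive ε →
  (Σ ℕ λ N → ∀ n → N ≤ n → r n ℚ.≤ L ℚ.+ ε) ×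
  (∀ N → Σ ℕ λ n → N ≤ n × (L ℚ.- ε ℚ.≤ r n))

{-# OPTIONS --safe #-}

-- A toothpick centred at P is vertical or horizontal according to the parity of the
-- coordinate sum of P, so a point P can only be reached from two opposite neighbours, and
-- it is added right after exactly one of them has been.  Hence its birth time is one more
-- than the smaller birth time of the two neighbours, and infinite if these agree.  The
-- birth times are self-similar: for s = 2^k, those on [0,2s) × [0,2s] are made of those on
-- [0,s) × [0,s] and of three delayed copies of them, reflected, rotated and translated.
-- With m = 2s this gives T(m+i) + 1 = T(m) + 2 T(i) + T(i+1) for 0 < i < m.  The deficit
-- f(n) = 2n² + n - 3 T(n) then satisfies f(m) = m - 1 and
--   f(m+i) = i(4j-5) + j - 1 + 2 f(i) + f(i+1),   j = m - i,
-- which is positive for j ≥ 2 and equals 2 f(m-1) for j = 1.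
module Submission where

open import Defs

-- The obstacle is interference between the blocks along the lines `x = s` and `y = s`. The block
-- `[0,s) × [0,s]` completes its last column at time `2s - 1` and its top row at time `2s`, at odd
-- positions only; the copies beyond these borders start so late that they cannot change those
-- times, and the empty even positions play the part of the empty axis of a copy. The toothpick at
-- `(s-1 , s)`, born at `2s`, serves as the first toothpick of the turned copy. Its end `(s , s)`,
-- born at `2s + 1`, is the second toothpick of that copy and the first of the two others; hence the
-- delays `2s - 1` and `2s`, and hence `T(i+1)` beside `2 T(i)`. The seam between the turned copy
-- and the upper right one needs a symmetry of the birth times themselves, `diagonal`, which is
-- carried along in the induction. A finite patch omits the point `(s , s)`, so it describes the
-- true structure only through stage `2s`; that is why the patches must keep doubling.

module BirthTimes where
  open import Data.Bool using (Bool; true; false; if_then_else_; _∨_; _xor_)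
  open import Data.Bool.Properties using (∨-zeroʳ; xor-identityʳ)
  open import Data.Empty using (⊥-elim)
  open import Data.Maybe using (Maybe; just; nothing; map)
  open import Data.Nat
  open import Data.Nat.Properties
  open import Data.Parity.Base using (0ℙ; 1ℙ; _⁻¹)
  import Data.Parity.Base as ℙ
  import Data.Parity.Properties as ℙ
  open import Data.Product using (_×_; _,_)
  open import Relation.Nullary using (¬_; does; contradiction)
  open import Relation.Nullary.Decidable using (dec-true; dec-false)
  open import Relation.Binary.PropositionalEquality
  open ≡-Reasoning

  -- Arithmetic of birth times.

  Time : Set
  Time = Maybe ℕ

  -- Birth time of a point whose two neighbours have the given birth times (nothing: never).
  infixl 6 _⊕_
  _⊕_ : Time → Time → Time
  nothing      ⊕ t            = map suc t
  just a       ⊕ nothing      = just (suc a)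
  just zero    ⊕ just zero    = nothing
  just zero    ⊕ just (suc b) = just 1
  just (suc a) ⊕ just zero    = just 1
  just (suc a) ⊕ just (suc b) = map suc (just a ⊕ just b)

  ⊕-comm : ∀ t u → t ⊕ u ≡ u ⊕ t
  ⊕-comm nothing nothing = refl
  ⊕-comm nothing (just _) = refl
  ⊕-comm (just _) nothing = refl
  ⊕-comm (just zero) (just zero) = refl
  ⊕-comm (just zero) (just (suc b)) = refl
  ⊕-comm (just (suc a)) (just zero) = refl
  ⊕-comm (just (suc a)) (just (suc b)) = cong (map suc) (⊕-comm (just a) (just b))

  ⊕-self : ∀ t → t ⊕ t ≡ nothing
  ⊕-self nothing = refl
  ⊕-self (just zero) = refl
  ⊕-self (just (suc a)) = cong (map suc) (⊕-self (just a))

  ⊕-later : ∀ {a b} t → t ⊕ nothing ≡ just a → a ≤ b → t ⊕ just b ≡ just a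
  ⊕-later (just zero) refl (s≤s _) = refl
  ⊕-later (just (suc a)) refl (s≤s a<b) = cong (map suc) (⊕-later (just a) refl a<b)


  delay : ℕ → Time → Time
  delay d nothing  = nothing
  delay d (just a) = just (d + a)

  -- This protects a block from its copies: a neighbour delayed by `d` comes too late to change a
  -- birth that `t` alone causes by time `d`.
  ⊕-delayed : ∀ {a d} t u → t ⊕ nothing ≡ just a → a ≤ d → t ⊕ delay d u ≡ just a
  ⊕-delayed t nothing  eq a≤d = eq
  ⊕-delayed t (just b) eq a≤d = ⊕-later t eq (≤-trans a≤d (m≤m+n _ b))

  delay-zero : ∀ t → delay 0 t ≡ t
  delay-zero nothing = refl
  delay-zero (just a) = refl

  delay-suc : ∀ d t → delay (suc d) t ≡ map suc (delay d t)
  delay-suc d nothing = refl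
  delay-suc d (just _) = refl

  delay-suc′ : ∀ d t → delay (suc d) t ≡ delay d (map suc t)
  delay-suc′ d nothing = refl
  delay-suc′ d (just a) = cong just (sym (+-suc d a))

  map-suc-⊕ : ∀ t u → map suc (t ⊕ u) ≡ map suc t ⊕ map suc u
  map-suc-⊕ nothing nothing = refl
  map-suc-⊕ nothing (just _) = refl
  map-suc-⊕ (just _) nothing = refl
  map-suc-⊕ (just _) (just _) = refl

  delay-⊕ : ∀ d t u → delay d (t ⊕ u) ≡ delay d t ⊕ delay d u
  delay-⊕ zero t u rewrite delay-zero t | delay-zero u = delay-zero (t ⊕ u)
  delay-⊕ (suc d) t u
    rewrite delay-suc d (t ⊕ u) | delay-suc d t | delay-suc d u | delay-⊕ d t u
    = map-suc-⊕ (delay d t) (delay d u)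

  ⊕-cong : ∀ {t u v t′ u′ v′} → t′ ≡ t → u′ ≡ u → v′ ≡ v → t ≡ u ⊕ v → t′ ≡ u′ ⊕ v′
  ⊕-cong refl refl refl eq = eq

  ⊕-delay : ∀ d {t u v t′ u′ v′} → t′ ≡ delay d t → u′ ≡ delay d u → v′ ≡ delay d v →
            t ≡ u ⊕ v → t′ ≡ u′ ⊕ v′
  ⊕-delay d {u = u} {v} refl refl refl refl = delay-⊕ d u v

  born : ℕ → Time → Bool
  born n       nothing        = false
  born n       (just zero)    = true
  born zero    (just (suc a)) = false
  born (suc n) (just (suc a)) = born n (just a)

  born-map-suc : ∀ n t → born n (map suc t) ∨ born n t ≡ born n t
  born-map-suc n nothing = refl
  born-map-suc n (just zero) = ∨-zeroʳ (born n (just 1))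
  born-map-suc zero (just (suc a)) = refl
  born-map-suc (suc n) (just (suc a)) = born-map-suc n (just a)

  not-born-0-⊕ : ∀ a b → born 0 (just a ⊕ just b) ≡ false
  not-born-0-⊕ zero zero = refl
  not-born-0-⊕ zero (suc b) = refl
  not-born-0-⊕ (suc a) zero = refl
  not-born-0-⊕ (suc a) (suc b) with just a ⊕ just b
  ... | nothing = refl
  ... | just c  = refl

  -- Turns birth times into the growth rule of the structure. If exactly one neighbour is present at
  -- time `n`, the two times differ and the smaller is at most `n`. Conversely a birth at exactly
  -- `n + 1` means that one neighbour came at `n` and the other later or never.
  born-suc-⊕ : ∀ n t u → born (suc n) (t ⊕ u) ≡ born n (t ⊕ u) ∨ (born n t xor born n u)
  born-suc-⊕ n nothing nothing = refl
  born-suc-⊕ n nothing (just b) = sym (born-map-suc n (just b))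
  born-suc-⊕ n (just a) nothing =
    sym (trans (cong (born n (just (suc a)) ∨_) (xor-identityʳ _)) (born-map-suc n (just a)))
  born-suc-⊕ n (just zero) (just zero) = refl
  born-suc-⊕ zero (just zero) (just (suc b)) = refl
  born-suc-⊕ (suc n) (just zero) (just (suc b)) = refl
  born-suc-⊕ zero (just (suc a)) (just zero) = refl
  born-suc-⊕ (suc n) (just (suc a)) (just zero) = refl
  born-suc-⊕ zero (just (suc a)) (just (suc b)) with just a ⊕ just b | not-born-0-⊕ a b
  ... | nothing | _ = refl
  ... | just (suc c) | _ = refl
  born-suc-⊕ (suc n) (just (suc a)) (just (suc b)) with just a ⊕ just b | born-suc-⊕ n (just a) (just b)
  ... | nothing | eq = eq
  ... | just c | eq = eq

  born-suc : ∀ n t → born n t ≡ true → born (suc n) t ≡ true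
  born-suc n (just zero) _ = refl
  born-suc (suc n) (just (suc a)) eq = born-suc n (just a) eq

  born-≤ : ∀ {a n} → a ≤ n → born n (just a) ≡ true
  born-≤ z≤n = refl
  born-≤ (s≤s a≤n) = born-≤ a≤n

  not-born-> : ∀ {a n} → n < a → born n (just a) ≡ false
  not-born-> {suc a} {zero} _ = refl
  not-born-> {suc a} {suc n} (s≤s n<a) = not-born-> n<a

  not-born-0-delay : ∀ d t → born 0 t ≡ false → born 0 (delay d t) ≡ false
  not-born-0-delay d nothing _ = refl
  not-born-0-delay d (just (suc a)) _ rewrite +-suc d a = refl

  parity-suc : ∀ n → parity (suc n) ≡ parity n ⁻¹
  parity-suc zero = refl
  parity-suc (suc n) = sym (ℙ.suc-homo-⁻¹ n)

  odd⇒positive : ∀ n → parity n ≡ 1ℙ → 0 < n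
  odd⇒positive (suc n) _ = z<s

  parity-+-even : ∀ m n → parity (m + n) ≡ 0ℙ → parity m ≡ parity n
  parity-+-even m n eq with parity m | parity n | trans (sym (ℙ.+-homo-+ m n)) eq
  ... | 0ℙ | 0ℙ | _ = refl
  ... | 1ℙ | 1ℙ | _ = refl

  parity-suc-injective : ∀ m n → parity (suc m) ≡ parity (suc n) → parity m ≡ parity n
  parity-suc-injective m n eq rewrite parity-suc m | parity-suc n with parity m | parity n
  ... | 0ℙ | 0ℙ = refl
  ... | 1ℙ | 1ℙ = refl

  parity-suc-cong : ∀ m n → parity m ≡ parity n → parity (suc m) ≡ parity (suc n)
  parity-suc-cong m n eq rewrite parity-suc m | parity-suc n = cong _⁻¹ eq

  -- Around the corner (s , s) the structure restarts at time 2s: the half plane above the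
  -- corner repeats the original one, the block to its lower right is a quarter turn of it,
  -- one stage ahead.
  glue : ℕ → (ℕ → ℕ → Time) → ℕ → ℕ → Time
  glue s F x y =
    if does (x <? s)
    then (if does (y ≤? s) then F x y else delay (s + s) (F (s ∸ x) (y ∸ s)))
    else (if does (s ≤? y) then delay (s + s) (F (x ∸ s) (y ∸ s))
                           else delay (pred s + s) (F (s ∸ y) (suc (x ∸ s))))

  -- F gives the birth times of the points of [0,s) × [0,s], and nothing outside.  There the
  -- rule fails only at (s , s), the corner from which the next block starts.
  record Patch (w : ℕ) (F : ℕ → ℕ → Time) : Set where
    s : ℕ
    s = suc w
    field
      s-even     : parity s ≡ 0ℙ
      origin     : F 0 0 ≡ just 1
      above      : F 0 1 ≡ just 2
      y-axis     : ∀ y → F 0 (2 + y) ≡ nothing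
      x-axis     : ∀ x → F (suc x) 0 ≡ nothing
      beyond-x   : ∀ {x} y → s ≤ x → F x y ≡ nothing
      beyond-y   : ∀ x {y} → s < y → F x y ≡ nothing
      col-odd    : ∀ {y} → y < s → parity y ≡ 1ℙ → F w y ≡ just (w + s)
      col-even   : ∀ {y} → y < s → parity y ≡ 0ℙ → F w y ≡ nothing
      row-odd    : ∀ {x} → x < s → parity x ≡ 1ℙ → F x s ≡ just (s + s)
      row-even   : ∀ {x} → x < s → parity x ≡ 0ℙ → F x s ≡ nothing
      -- Needed where the turned copy lies below the upper right one: the points facing each other
      -- across the seam carry `F 1 (suc u)` and `F u 1`. The lead of one stage cancels the `suc`,
      -- so they are born together and the seam stays empty.
      diagonal   : ∀ u → parity u ≡ 1ℙ → F 1 (suc u) ≡ map suc (F u 1)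
      not-born-0 : ∀ x y → born 0 (F x y) ≡ false
      horizontal : ∀ x y → parity x ≡ parity y → ¬ (x ≡ w × y ≡ w) →
                   F (suc x) (suc y) ≡ F x (suc y) ⊕ F (2 + x) (suc y)
      vertical   : ∀ x y → parity x ≡ parity (suc y) →
                   F (suc x) (suc y) ≡ F (suc x) y ⊕ F (suc x) (2 + y)

  -- Gluing four blocks into a patch of twice the size.

  -- The rule is stated at `suc x`, so the three cases place `suc x` before, on or beyond the border
  -- `s = suc w`. The equations carry the coordinate inside the copy: in `before`, `suc u` is the
  -- reflected coordinate `s - suc x`.
  data Side (w x : ℕ) : Set where
    before : ∀ u → suc u + x ≡ w → Side w x
    at     : x ≡ w → Side w x
    after  : ∀ u → x ≡ u + suc w → Side w x

  side : ∀ w x → Side w x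
  side w x with compare x w
  ... | less .x u    = before u (cong suc (+-comm u x))
  ... | equal .x     = at refl
  ... | greater .w u = after u (trans (cong suc (+-comm w u)) (sym (+-suc u w)))

  ≤-from-+ : ∀ {m n} k → k + m ≡ n → m ≤ n
  ≤-from-+ {m} k refl = m≤n+m m k

  module Glue {w F} (patch : Patch w F) where
    open Patch patch
    G : ℕ → ℕ → Time
    G = glue s F

    low : ∀ {x y} → x < s → y ≤ s → G x y ≡ F x y
    low {x} {y} x<s y≤s rewrite dec-true (x <? s) x<s | dec-true (y ≤? s) y≤s = refl

    ur : ∀ {x y} u v → x ≡ u + s → y ≡ v + s → G x y ≡ delay (s + s) (F u v)
    ur u v refl refl
      rewrite dec-false (u + s <? s) (λ lt → <-irrefl refl (≤-<-trans (m≤n+m s u) lt))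
            | dec-true (s ≤? v + s) (m≤n+m s v) | m+n∸n≡m u s | m+n∸n≡m v s = refl

    ul : ∀ {x y} u v → u + x ≡ s → y ≡ suc v + s → G x y ≡ delay (s + s) (F u (suc v))
    ul zero v refl e = ur 0 (suc v) refl e
    ul {x} (suc u) v e refl
      rewrite dec-true (x <? s) (subst (x <_) e (s≤s (m≤n+m x u)))
            | dec-false (suc v + s ≤? s) (λ le → <-irrefl refl (≤-trans (s≤s (m≤n+m s v)) le))
            | m+n∸n≡m (suc v) s | sym e | m+n∸n≡m (suc u) x = refl

    -- The range includes `v = 0`, the line `y = s`, although `glue` assigns that line to the upper
    -- right copy. Both descriptions agree there: at the corner both give `2s + 1`, and further
    -- right both axes are empty. Neighbours on that line can therefore be read off in either copy.
    br : ∀ {x y} u v → x ≡ u + s → v + y ≡ s → G x y ≡ delay (w + s) (F v (suc u))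
    br {x} zero zero refl refl = trans (ur 0 0 refl refl)
      (trans (cong (delay (s + s)) origin)
        (trans (cong just (sym (+-suc (w + s) 1))) (sym (cong (delay (w + s)) above))))
    br (suc u) zero refl refl =
      trans (ur (suc u) 0 refl refl) (trans (cong (delay (s + s)) (x-axis u)) (sym (cong (delay (w + s)) (y-axis u))))
    br {x} {y} u (suc v) refl e
      rewrite dec-false (u + s <? s) (λ lt → <-irrefl refl (≤-<-trans (m≤n+m s u) lt))
            | dec-false (s ≤? y) (<⇒≱ (subst (y <_) e (s≤s (m≤n+m y v))))
            | m+n∸n≡m u s | sym e | m+n∸n≡m (suc v) y = refl

    w-odd : parity w ≡ 1ℙ
    w-odd with parity w | parity-suc w
    ... | 1ℙ | _  = refl
    ... | 0ℙ | eq = contradiction (trans (sym s-even) eq) λ ()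

    parity-+s : ∀ u → parity (u + s) ≡ parity u
    parity-+s u = begin
      parity (u + s)             ≡⟨ ℙ.+-homo-+ u s ⟩
      parity u ℙ.+ parity s      ≡⟨ cong (parity u ℙ.+_) s-even ⟩
      parity u ℙ.+ 0ℙ            ≡⟨ ℙ.+-identityʳ (parity u) ⟩
      parity u                   ∎

    reflect-parity : ∀ u x → u + x ≡ s → parity u ≡ parity x
    reflect-parity u x e = parity-+-even u x (trans (cong parity e) s-even)

    module Before u {x} (e : suc u + x ≡ w) where
      e0 : 2 + u + x ≡ s
      e0 = cong suc e
      e1 : suc u + suc x ≡ s
      e1 = cong suc (trans (+-suc u x) e)
      e2 : u + (2 + x) ≡ s
      e2 = trans (+-suc u (suc x)) e1
      x<w : x < w
      x<w = ≤-from-+ u (trans (+-suc u x) e)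
      u<w : u < w
      u<w = subst (u <_) e (s≤s (m≤m+n u x))
      parity-eq : parity u ≡ parity x
      parity-eq = reflect-parity (2 + u) x e0

    -- The case `x = 0` missing from `vertical`; the axis of the upper copies becomes the column
    -- `x = s` of the glued patch.
    y-axis-rule : ∀ v → parity v ≡ 0ℙ → F 0 (suc v) ≡ F 0 v ⊕ F 0 (2 + v)
    y-axis-rule zero _ = ⊕-cong above origin (y-axis 0) refl
    y-axis-rule (suc (suc v)) _ = ⊕-cong (y-axis (suc v)) (y-axis v) (y-axis (2 + v)) refl

    -- The lines `x = s` and `y = s` leave nine positions for `(suc x , suc y)`. Inside a block the
    -- rule is inherited from `F`: a reflection swaps the two neighbours, and the quarter turn
    -- exchanges `horizontal` with `vertical`. Parity excludes the points right next to the corner;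
    -- what remains is to compare neighbours across the borders.
    G-horizontal : ∀ x y → parity x ≡ parity y → ¬ (x ≡ w + s × y ≡ w + s) →
                   G (suc x) (suc y) ≡ G x (suc y) ⊕ G (2 + x) (suc y)
    G-horizontal x y p ne with side w x | side w y
    -- Last column of the old block: its right neighbours are delayed by `w + s`, the very time at
    -- which the column is filled from the left.
    ... | before zero e | before v f =
      ⊕-cong (trans (low (s≤s x<w) (s≤s (<⇒≤ y<w))) col)
             (low (m<n⇒m<1+n x<w) (s≤s (<⇒≤ y<w)))
             (br 0 (suc v) e2 f1)
             (sym (⊕-delayed (F x (suc y)) (F (suc v) 1) edge ≤-refl))
      where
      open Before zero e
      open Before v f using () renaming (e1 to f1; x<w to y<w)
      col : F (suc x) (suc y) ≡ just (w + s)
      col = trans (cong (λ z → F z (suc y)) e)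
                  (col-odd (s≤s y<w) (trans (parity-suc-cong y x (sym p)) (trans (cong parity e) w-odd)))
      edge : F x (suc y) ⊕ nothing ≡ just (w + s)
      edge = begin
        F x (suc y) ⊕ nothing             ≡⟨ cong (F x (suc y) ⊕_) (beyond-x (suc y) (≤-reflexive (sym e2))) ⟨
        F x (suc y) ⊕ F (2 + x) (suc y)   ≡⟨ horizontal x y p (λ (q , _) → <⇒≢ x<w q) ⟨
        F (suc x) (suc y)                 ≡⟨ col ⟩
        just (w + s)                      ∎
    ... | before zero e | at refl =
      contradiction (trans (sym w-odd) (trans (sym p) (trans (cong (λ z → parity (suc z)) e) s-even))) λ ()
    ... | before (suc u) e | before v f =
      ⊕-cong (low (s≤s x<w) (s≤s (<⇒≤ y<w))) (low (m<n⇒m<1+n x<w) (s≤s (<⇒≤ y<w)))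
             (low (≤-from-+ u (trans (+-suc u (2 + x)) e2)) (s≤s (<⇒≤ y<w)))
             (horizontal x y p (λ (q , _) → <⇒≢ x<w q))
      where
      open Before (suc u) e
      open Before v f using () renaming (x<w to y<w)
    ... | before (suc u) e | at refl =
      ⊕-cong (low (s≤s x<w) ≤-refl) (low (m<n⇒m<1+n x<w) ≤-refl)
             (low (≤-from-+ u (trans (+-suc u (2 + x)) e2)) ≤-refl)
             (horizontal x y p (λ (q , _) → <⇒≢ x<w q))
      where open Before (suc u) e
    ... | before u e | after v refl =
      ⊕-delay (s + s) (ul (suc u) v e1 refl) (ul (2 + u) v e0 refl) (ul u v e2 refl)
        (trans (horizontal u v (trans parity-eq (trans p (parity-+s v))) (λ (q , _) → <⇒≢ u<w q))
               (⊕-comm (F u (suc v)) (F (2 + u) (suc v))))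
      where open Before u e
    -- The column `x = s` is row 1 of the turned copy. Its row 0 is played by the last column of the
    -- old block, which at even heights is empty like the axis.
    ... | at refl | before v f =
      ⊕-delay (w + s) (br 0 (suc v) refl e1)
        (trans (low ≤-refl (s≤s (<⇒≤ x<w)))
          (trans (col-even (s≤s x<w) (trans (parity-suc-cong y w (sym p)) s-even))
                 (sym (cong (delay (w + s)) (x-axis v)))))
        (br 1 (suc v) refl e1) (vertical v 0 (trans parity-eq (trans (sym p) w-odd)))
      where open Before v f
    -- The one point where the rule of `F` fails: it is born from `(w , s)` alone at `2s + 1`, which
    -- is the delayed origin of the upper copies.
    ... | at refl | at refl =
      ⊕-cong (trans (ur 0 0 refl refl) (cong (delay (s + s)) origin))
             (trans (low ≤-refl ≤-refl) (row-odd ≤-refl w-odd))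
             (trans (ur 1 0 refl refl) (cong (delay (s + s)) (x-axis 0)))
             (cong just (+-comm (s + s) 1))
    ... | at refl | after zero refl = contradiction (trans (sym w-odd) (trans p s-even)) λ ()
    -- On the axis above the corner the two upper copies are mirror images, so the neighbours agree
    -- and nothing is born.
    ... | at refl | after (suc v) refl =
      ⊕-cong (trans (ur 0 (2 + v) refl refl) (cong (delay (s + s)) (y-axis v)))
             (ul 1 (suc v) refl refl) (ur 1 (2 + v) refl refl) (sym (⊕-self (delay (s + s) (F 1 (2 + v)))))
    ... | after u refl | before v f =
      ⊕-delay (w + s) (br (suc u) (suc v) refl e1) (br u (suc v) refl e1) (br (2 + u) (suc v) refl e1)
        (vertical v (suc u) (trans parity-eq (trans (sym p) (parity-+s u))))
      where open Before v f
    ... | after zero refl | at refl = contradiction (trans (sym w-odd) (trans (sym p) s-even)) λ ()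
    ... | after (suc u) refl | at refl =
      ⊕-delay (s + s) (ur (2 + u) 0 refl refl) (ur (suc u) 0 refl refl) (ur (3 + u) 0 refl refl)
        (⊕-cong (x-axis (suc u)) (x-axis u) (x-axis (2 + u)) refl)
    ... | after u refl | after v refl =
      ⊕-delay (s + s) (ur (suc u) (suc v) refl refl) (ur u (suc v) refl refl) (ur (2 + u) (suc v) refl refl)
        (horizontal u v (trans (sym (parity-+s u)) (trans p (parity-+s v)))
          (λ (q , r) → ne (cong (_+ s) q , cong (_+ s) r)))

    G-vertical : ∀ x y → parity x ≡ parity (suc y) →
                 G (suc x) (suc y) ≡ G (suc x) y ⊕ G (suc x) (2 + y)
    G-vertical x y p with side w x | side w y
    ... | before u e | before v f =
      ⊕-cong (low (s≤s x<w) (s≤s (<⇒≤ y<w))) (low (s≤s x<w) (m≤n⇒m≤1+n (<⇒≤ y<w))) (low (s≤s x<w) (s≤s y<w))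
             (vertical x y p)
      where
      open Before u e
      open Before v f using () renaming (x<w to y<w)
    -- Top row of the old block: it is filled from below at time `2s`, and the copy above is delayed
    -- by that amount.
    ... | before u e | at refl =
      ⊕-cong (trans (low (s≤s x<w) ≤-refl) row) (low (s≤s x<w) (n≤1+n w)) (ul (suc u) 0 e1 refl)
             (sym (⊕-delayed (F (suc x) w) (F (suc u) 1) edge ≤-refl))
      where
      open Before u e
      row : F (suc x) s ≡ just (s + s)
      row = row-odd (s≤s x<w) (trans (parity-suc-cong x s p) w-odd)
      edge : F (suc x) w ⊕ nothing ≡ just (s + s)
      edge = begin
        F (suc x) w ⊕ nothing             ≡⟨ cong (F (suc x) w ⊕_) (beyond-y (suc x) ≤-refl) ⟨
        F (suc x) w ⊕ F (suc x) (2 + w)   ≡⟨ vertical x w p ⟨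
        F (suc x) s                       ≡⟨ row ⟩
        just (s + s)                      ∎
    ... | before u e | after v refl =
      ⊕-delay (s + s) (ul (suc u) v e1 refl) (down v p) (ul (suc u) (suc v) e1 refl)
        (vertical u v (trans parity-eq (trans p (parity-+s (suc v)))))
      where
      open Before u e
      -- For `v = 0` the lower neighbour lies in the top row of the old block, at an even abscissa,
      -- hence empty like the axis of the copy.
      down : ∀ v → parity x ≡ parity (suc (v + s)) → G (suc x) (v + s) ≡ delay (s + s) (F (suc u) v)
      down zero p = begin
        G (suc x) s                    ≡⟨ low (s≤s x<w) ≤-refl ⟩
        F (suc x) s                    ≡⟨ row-even (s≤s x<w) (trans (parity-suc-cong x w p) s-even) ⟩
        nothing                        ≡⟨ cong (delay (s + s)) (x-axis u) ⟨
        delay (s + s) (F (suc u) 0)    ∎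
      down (suc v) _ = ul (suc u) v e1 refl
    ... | at refl | before v f =
      ⊕-delay (w + s) (br 0 (suc v) refl e1) (br 0 (2 + v) refl e0) (br 0 v refl e2)
        (trans (horizontal v 0 (trans parity-eq (parity-suc-injective y 0 (trans (sym p) w-odd)))
                              (λ (q , _) → <⇒≢ u<w q))
               (⊕-comm (F v 1) (F (2 + v) 1)))
      where open Before v f
    ... | at refl | at refl = contradiction (trans (sym w-odd) (trans p s-even)) λ ()
    ... | at refl | after v refl =
      ⊕-delay (s + s) (ur 0 (suc v) refl refl) (ur 0 v refl refl) (ur 0 (2 + v) refl refl)
        (y-axis-rule v (parity-suc-injective v 0 (trans (sym (parity-+s (suc v))) (trans (sym p) w-odd))))
    ... | after u refl | before v f =
      ⊕-delay (w + s) (br (suc u) (suc v) refl e1) (br (suc u) (2 + v) refl e0) (br (suc u) v refl e2)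
        (trans (horizontal v (suc u)
                 (trans parity-eq (trans (parity-suc-cong (suc y) (u + s) (sym p)) (parity-+s (suc u))))
                 (λ (q , _) → <⇒≢ u<w q))
               (⊕-comm (F v (2 + u)) (F (2 + v) (2 + u))))
      where open Before v f
    ... | after u refl | at refl =
      ⊕-cong (trans (ur (suc u) 0 refl refl) (cong (delay (s + s)) (x-axis u)))
             (br (suc u) 1 refl refl) (ur (suc u) 1 refl refl)
             (sym (begin
               delay (w + s) (F 1 (2 + u)) ⊕ delay (s + s) (F (suc u) 1)
                 ≡⟨ cong (λ t → delay (w + s) t ⊕ delay (s + s) (F (suc u) 1)) (diagonal (suc u) u-odd) ⟩
               delay (w + s) (map suc (F (suc u) 1)) ⊕ delay (s + s) (F (suc u) 1)
                 ≡⟨ cong (_⊕ delay (s + s) (F (suc u) 1)) (delay-suc′ (w + s) (F (suc u) 1)) ⟨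
               delay (s + s) (F (suc u) 1) ⊕ delay (s + s) (F (suc u) 1)
                 ≡⟨ ⊕-self (delay (s + s) (F (suc u) 1)) ⟩
               nothing ∎))
      where
      u-odd : parity (suc u) ≡ 1ℙ
      u-odd = trans (sym (parity-+s (suc u))) (trans (parity-suc-cong (u + s) s p) w-odd)
    ... | after u refl | after v refl =
      ⊕-delay (s + s) (ur (suc u) (suc v) refl refl) (ur (suc u) v refl refl) (ur (suc u) (2 + v) refl refl)
        (vertical u v (trans (sym (parity-+s u)) (trans p (parity-+s (suc v)))))

    data Across (b x : ℕ) : Set where
      near : ∀ u → suc u + x ≡ b → Across b x
      far  : ∀ u → x ≡ u + b → Across b x

    across : ∀ x → Across s x
    across x with side w x
    ... | before u e = near (suc u) (cong suc e)
    ... | at e       = near 0 (cong suc e)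
    ... | after u e  = far u e

    near-< : ∀ {u x} → suc u + x ≡ s → x < s
    near-< {u} {x} e = ≤-from-+ u (trans (+-suc u x) e)

    mirror-< : ∀ {u x} → suc u + suc x ≡ s → suc u < s
    mirror-< {u} {x} e = subst (suc u <_) e (m<m+n (suc u) z<s)

    1<s : 1 < s
    1<s = s≤s (odd⇒positive w w-odd)

    glue-patch : Patch (w + s) G
    glue-patch .Patch.s-even = trans (parity-+s s) s-even
    glue-patch .Patch.origin = trans (low z<s z≤n) origin
    glue-patch .Patch.above  = trans (low z<s (s≤s z≤n)) above
    glue-patch .Patch.y-axis y with across (suc y)
    ... | near v e = trans (low z<s (near-< e)) (y-axis y)
    ... | far v e  = trans (ul s v (+-identityʳ s) (cong suc e)) (cong (delay (s + s)) (beyond-x (suc v) ≤-refl))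
    glue-patch .Patch.x-axis x with across (suc x)
    ... | near u e = trans (low (near-< e) z≤n) (x-axis x)
    ... | far u e  = trans (br u s e (+-identityʳ s)) (cong (delay (w + s)) (beyond-x (suc u) ≤-refl))
    glue-patch .Patch.beyond-x {x} y le with across x | across y
    ... | near u e    | _         = contradiction (≤-trans (m≤m+n s s) le) (<⇒≱ (near-< e))
    ... | far u refl  | near v f  =
      trans (br u (suc v) refl f) (cong (delay (w + s)) (beyond-y (suc v) (s≤s (+-cancelʳ-≤ s s u le))))
    ... | far u refl  | far v f   =
      trans (ur u v refl f) (cong (delay (s + s)) (beyond-x v (+-cancelʳ-≤ s s u le)))
    glue-patch .Patch.beyond-y x {y} lt with across x | across y
    ... | _         | near v f       = contradiction (≤-trans (m≤m+n s s) (<⇒≤ lt)) (<⇒≱ (near-< f))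
    ... | near u e  | far zero refl  = contradiction (≤-trans lt (m≤m+n s s)) (<-irrefl refl)
    ... | near u e  | far (suc v) refl =
      trans (ul (suc u) v e refl) (cong (delay (s + s)) (beyond-y (suc u) (+-cancelʳ-< s s (suc v) lt)))
    ... | far u e   | far v refl     =
      trans (ur u v e refl) (cong (delay (s + s)) (beyond-y u (+-cancelʳ-< s s v lt)))
    glue-patch .Patch.col-odd {suc y} lt p with across (suc y)
    -- The quarter turn makes the top row of `F` the lower half of the new last column; the delay
    -- `2s - 1` takes its time `2s` to the required `4s - 1`.
    ... | near v f     = trans (br w (suc v) refl f)
      (cong (delay (w + s)) (row-odd (mirror-< f) (trans (reflect-parity (suc v) (suc y) f) p)))
    ... | far v e = trans (ur w v refl e)
      (trans (cong (delay (s + s)) (col-odd (+-cancelʳ-< s v s (subst (_< s + s) e lt))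
                                            (trans (sym (parity-+s v)) (trans (cong parity (sym e)) p))))
             (cong just (+-comm (s + s) (w + s))))
    glue-patch .Patch.col-even {zero} lt p =
      trans (br w s refl (+-identityʳ s)) (cong (delay (w + s)) (beyond-x s ≤-refl))
    glue-patch .Patch.col-even {suc y} lt p with across (suc y)
    ... | near v f     = trans (br w (suc v) refl f)
      (cong (delay (w + s)) (row-even (mirror-< f) (trans (reflect-parity (suc v) (suc y) f) p)))
    ... | far v e = trans (ur w v refl e)
      (cong (delay (s + s)) (col-even (+-cancelʳ-< s v s (subst (_< s + s) e lt))
                                      (trans (sym (parity-+s v)) (trans (cong parity (sym e)) p))))
    glue-patch .Patch.row-odd {suc x} lt p with across (suc x)
    ... | near u e = trans (ul (suc u) w e refl)
      (cong (delay (s + s)) (row-odd (mirror-< e) (trans (reflect-parity (suc u) (suc x) e) p)))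
    ... | far u e = trans (ur u s e refl)
      (cong (delay (s + s)) (row-odd (+-cancelʳ-< s u s (subst (_< s + s) e lt))
                                     (trans (sym (parity-+s u)) (trans (cong parity (sym e)) p))))
    glue-patch .Patch.row-even {zero} lt p =
      trans (ul s w (+-identityʳ s) refl) (cong (delay (s + s)) (beyond-x s ≤-refl))
    glue-patch .Patch.row-even {suc x} lt p with across (suc x)
    ... | near u e = trans (ul (suc u) w e refl)
      (cong (delay (s + s)) (row-even (mirror-< e) (trans (reflect-parity (suc u) (suc x) e) p)))
    ... | far u e = trans (ur u s e refl)
      (cong (delay (s + s)) (row-even (+-cancelʳ-< s u s (subst (_< s + s) e lt))
                                      (trans (sym (parity-+s u)) (trans (cong parity (sym e)) p))))
    glue-patch .Patch.diagonal u p with across u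
    ... | near v e =
      trans (low 1<s (near-< e)) (trans (diagonal u p) (cong (map suc) (sym (low (near-< e) (<⇒≤ 1<s)))))
    -- Both points are images of the same `F w (suc v)`, one under the reflection and one under the
    -- quarter turn, whose delays differ by one.
    ... | far v refl =
      trans (ul w v (+-comm w 1) refl)
            (trans (delay-suc (w + s) (F w (suc v))) (cong (map suc) (sym (br v w refl (+-comm w 1)))))
    glue-patch .Patch.not-born-0 x y with does (x <? s) | does (y ≤? s) | does (s ≤? y)
    ... | true  | true  | _     = not-born-0 x y
    ... | true  | false | _     = not-born-0-delay (s + s) (F (s ∸ x) (y ∸ s)) (not-born-0 (s ∸ x) (y ∸ s))
    ... | false | _     | true  = not-born-0-delay (s + s) (F (x ∸ s) (y ∸ s)) (not-born-0 (x ∸ s) (y ∸ s))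
    ... | false | _     | false = not-born-0-delay (w + s) (F (s ∸ y) (suc (x ∸ s))) (not-born-0 (s ∸ y) (suc (x ∸ s)))
    glue-patch .Patch.horizontal = G-horizontal
    glue-patch .Patch.vertical = G-vertical

  -- The initial patch and its repeated doubling.

  -- Stages one to four in doubled coordinates, with `s = 2`: each stage contributes one point with
  -- nonnegative coordinates.
  F₀ : ℕ → ℕ → Time
  F₀ 0 0 = just 1
  F₀ 0 1 = just 2
  F₀ 1 1 = just 3
  F₀ 1 2 = just 4
  F₀ _ _ = nothing

  patch₀ : Patch 1 F₀
  patch₀ .Patch.s-even = refl
  patch₀ .Patch.origin = refl
  patch₀ .Patch.above = refl
  patch₀ .Patch.y-axis y = refl
  patch₀ .Patch.x-axis 0 = refl
  patch₀ .Patch.x-axis (suc x) = refl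
  patch₀ .Patch.beyond-x {suc (suc x)} y le = refl
  patch₀ .Patch.beyond-x {1} y (s≤s ())
  patch₀ .Patch.beyond-y 0 {suc (suc (suc y))} lt = refl
  patch₀ .Patch.beyond-y 1 {suc (suc (suc y))} lt = refl
  patch₀ .Patch.beyond-y (suc (suc x)) lt = refl
  patch₀ .Patch.beyond-y x {2} (s≤s (s≤s ()))
  patch₀ .Patch.beyond-y x {1} (s≤s ())
  patch₀ .Patch.col-odd {1} lt p = refl
  patch₀ .Patch.col-odd {suc (suc y)} (s≤s (s≤s ())) p
  patch₀ .Patch.col-even {0} lt p = refl
  patch₀ .Patch.col-even {suc (suc y)} (s≤s (s≤s ())) p
  patch₀ .Patch.row-odd {1} lt p = refl
  patch₀ .Patch.row-odd {suc (suc y)} (s≤s (s≤s ())) p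
  patch₀ .Patch.row-even {0} lt p = refl
  patch₀ .Patch.row-even {suc (suc y)} (s≤s (s≤s ())) p
  patch₀ .Patch.diagonal 1 p = refl
  patch₀ .Patch.diagonal (suc (suc (suc u))) p = refl
  patch₀ .Patch.not-born-0 0 0 = refl
  patch₀ .Patch.not-born-0 0 1 = refl
  patch₀ .Patch.not-born-0 0 (suc (suc y)) = refl
  patch₀ .Patch.not-born-0 1 0 = refl
  patch₀ .Patch.not-born-0 1 1 = refl
  patch₀ .Patch.not-born-0 1 2 = refl
  patch₀ .Patch.not-born-0 1 (suc (suc (suc y))) = refl
  patch₀ .Patch.not-born-0 (suc (suc x)) y = refl
  patch₀ .Patch.horizontal 0 0 p ne = refl
  patch₀ .Patch.horizontal 0 (suc (suc y)) p ne = refl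
  patch₀ .Patch.horizontal 1 1 p ne = ⊥-elim (ne (refl , refl))
  patch₀ .Patch.horizontal 1 (suc (suc y)) p ne = refl
  patch₀ .Patch.horizontal (suc (suc x)) y p ne = refl
  patch₀ .Patch.vertical 0 1 p = refl
  patch₀ .Patch.vertical 0 (suc (suc (suc y))) p = refl
  patch₀ .Patch.vertical (suc x) 0 p = refl
  patch₀ .Patch.vertical (suc x) (suc y) p = refl

  -- The side `suc (width k)` is `2 ^ (k + 1)`. Storing its predecessor makes the side a successor,
  -- and the next side is `s + s` by computation.
  width : ℕ → ℕ
  width zero    = 1
  width (suc k) = width k + suc (width k)

  birth : ℕ → ℕ → ℕ → Time
  birth zero    = F₀
  birth (suc k) = glue (suc (width k)) (birth k)

  birth-patch : ∀ k → Patch (width k) (birth k)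
  birth-patch zero    = patch₀
  birth-patch (suc k) = Glue.glue-patch (birth-patch k)

-- The lists of toothpicks: neighbours, exposure, absence of repetitions.

module Structure where
  open import Data.Bool using (Bool; true; false)
  import Data.Bool as Bool
  open import Data.Bool.Properties using (∨-zeroʳ)
  open import Data.Nat as ℕ using (ℕ; zero; suc; parity)
  import Data.Nat.Properties as ℕ
  open import Data.Integer as ℤ using (ℤ; +_; -[1+_]; ∣_∣; 0ℤ)
  import Data.Integer.Properties as ℤ
  open import Data.Integer.Tactic.RingSolver using (solve-∀)
  open import Algebra.Properties.AbelianGroup ℤ.+-0-abelianGroup using () renaming (∙-cancelˡ to +-cancelˡ)
  open import Data.List using (List; []; _∷_; map; filter)
  open import Data.List.Membership.Propositional using (_∈_; find; lose)
  open import Data.List.Membership.Propositional.Properties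
  open import Data.List.Relation.Unary.Any using (here; there)
  open import Data.List.Relation.Unary.All as All using (All; []; _∷_)
  open import Data.List.Relation.Unary.AllPairs as AllPairs using (AllPairs; []; _∷_)
  import Data.List.Relation.Unary.AllPairs.Properties as AllPairs
  import Data.List.Relation.Unary.All.Properties as All
  open import Data.List.Relation.Unary.Unique.Propositional using (Unique)
  import Data.List.Relation.Unary.Unique.Propositional.Properties as Unique
  open import Data.List.Relation.Binary.Disjoint.Propositional using (Disjoint)
  open import Data.Parity.Base using (Parity; 0ℙ; 1ℙ; _⁻¹)
  import Data.Parity.Base as ℙ
  import Data.Parity.Properties as ℙ
  open import Data.Product using (_×_; _,_; proj₁; proj₂; ∃)
  open import Data.Sum using (_⊎_; inj₁; inj₂)
  open import Function using (_∘_)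
  open import Relation.Nullary using (¬_; Dec; yes; no; contradiction)
  open import Relation.Binary.PropositionalEquality
  open BirthTimes

  step⁺ step⁻ : Orient → Point → Point
  step⁺ vert  (x , y) = x , y ℤ.+ + 1
  step⁺ horiz (x , y) = x ℤ.+ + 1 , y
  step⁻ vert  (x , y) = x , y ℤ.- + 1
  step⁻ horiz (x , y) = x ℤ.- + 1 , y

  ends-step : ∀ o p → ends (tp p o) ≡ step⁺ o p ∷ step⁻ o p ∷ []
  ends-step vert  (x , y) = refl
  ends-step horiz (x , y) = refl

  ∈-ends : ∀ {e} t → e ∈ ends t → e ≡ step⁺ (orient t) (center t) ⊎ e ≡ step⁻ (orient t) (center t)
  ∈-ends t e∈ with subst (_ ∈_) (ends-step (orient t) (center t)) e∈
  ... | here eq         = inj₁ eq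
  ... | there (here eq) = inj₂ eq

  step⁺-∈ : ∀ o p → step⁺ o p ∈ ends (tp p o)
  step⁺-∈ o p = subst (step⁺ o p ∈_) (sym (ends-step o p)) (here refl)

  step⁻-∈ : ∀ o p → step⁻ o p ∈ ends (tp p o)
  step⁻-∈ o p = subst (step⁻ o p ∈_) (sym (ends-step o p)) (there (here refl))

  +1-1 : ∀ i → i ≡ i ℤ.+ + 1 ℤ.- + 1
  +1-1 = solve-∀

  -1+1 : ∀ i → i ≡ i ℤ.- + 1 ℤ.+ + 1
  -1+1 = solve-∀

  step⁻-step⁺ : ∀ o p → p ≡ step⁻ o (step⁺ o p)
  step⁻-step⁺ vert  (x , y) = cong (x ,_) (+1-1 y)
  step⁻-step⁺ horiz (x , y) = cong (_, y) (+1-1 x)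

  step⁺-step⁻ : ∀ o p → p ≡ step⁺ o (step⁻ o p)
  step⁺-step⁻ vert  (x , y) = cong (x ,_) (-1+1 y)
  step⁺-step⁻ horiz (x , y) = cong (_, y) (-1+1 x)

  ends-sym : ∀ {e} t → e ∈ ends t → center t ∈ ends (tp e (orient t))
  ends-sym (tp c o) e∈ with ∈-ends (tp c o) e∈
  ... | inj₁ refl = subst (_∈ ends (tp (step⁺ o c) o)) (sym (step⁻-step⁺ o c)) (step⁻-∈ o (step⁺ o c))
  ... | inj₂ refl = subst (_∈ ends (tp (step⁻ o c) o)) (sym (step⁺-step⁻ o c)) (step⁺-∈ o (step⁻ o c))

  step⁺≢step⁻ : ∀ o p → step⁺ o p ≢ step⁻ o p
  step⁺≢step⁻ vert  (x , y) eq with () ← +-cancelˡ y (+ 1) (ℤ.- + 1) (cong proj₂ eq)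
  step⁺≢step⁻ horiz (x , y) eq with () ← +-cancelˡ x (+ 1) (ℤ.- + 1) (cong proj₁ eq)

  i≢i+1 : ∀ i → i ≢ i ℤ.+ + 1
  i≢i+1 i eq with () ← +-cancelˡ i 0ℤ (+ 1) (trans (ℤ.+-identityʳ i) eq)

  i≢i-1 : ∀ i → i ≢ i ℤ.- + 1
  i≢i-1 i eq with () ← +-cancelˡ i 0ℤ (ℤ.- + 1) (trans (ℤ.+-identityʳ i) eq)

  center∉ends : ∀ o p → ¬ p ∈ ends (tp p o)
  center∉ends o p p∈ with ∈-ends (tp p o) p∈
  center∉ends vert  p _ | inj₁ eq = i≢i+1 _ (cong proj₂ eq)
  center∉ends horiz p _ | inj₁ eq = i≢i+1 _ (cong proj₁ eq)
  center∉ends vert  p _ | inj₂ eq = i≢i-1 _ (cong proj₂ eq)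
  center∉ends horiz p _ | inj₂ eq = i≢i-1 _ (cong proj₁ eq)

  -- The plane is folded onto a quadrant by absolute values. At 0 both neighbours fold to the same
  -- point; for negative integers they change roles.
  ∣_∣-steps : ∀ i → (∣ i ∣ ≡ 0 × ∣ i ℤ.+ + 1 ∣ ≡ 1 × ∣ i ℤ.- + 1 ∣ ≡ 1)
                  ⊎ (∃ λ n → ∣ i ∣ ≡ suc n × ∣ i ℤ.+ + 1 ∣ ≡ 2 ℕ.+ n × ∣ i ℤ.- + 1 ∣ ≡ n)
                  ⊎ (∃ λ n → ∣ i ∣ ≡ suc n × ∣ i ℤ.+ + 1 ∣ ≡ n × ∣ i ℤ.- + 1 ∣ ≡ 2 ℕ.+ n)
  ∣ + zero ∣-steps    = inj₁ (refl , refl , refl)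
  ∣ + suc n ∣-steps   = inj₂ (inj₁ (n , refl , cong suc (ℕ.+-comm n 1) , refl))
  ∣ -[1+ zero ] ∣-steps  = inj₂ (inj₂ (0 , refl , refl , refl))
  ∣ -[1+ suc n ] ∣-steps = inj₂ (inj₂ (suc n , refl , refl , cong (suc ∘ suc ∘ suc) (ℕ.+-identityʳ n)))

  parity-step : ∀ i → parity ∣ i ℤ.+ + 1 ∣ ≡ parity ∣ i ∣ ⁻¹ × parity ∣ i ℤ.- + 1 ∣ ≡ parity ∣ i ∣ ⁻¹
  parity-step i with ∣ i ∣ | ∣ i ℤ.+ + 1 ∣ | ∣ i ℤ.- + 1 ∣ | ∣ i ∣-steps
  ... | _ | _ | _ | inj₁ (refl , refl , refl) = refl , refl
  ... | _ | _ | _ | inj₂ (inj₁ (n , refl , refl , refl)) = sym (ℙ.suc-homo-⁻¹ n) , sym (ℙ.suc-homo-⁻¹ n)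
  ... | _ | _ | _ | inj₂ (inj₂ (n , refl , refl , refl)) = sym (ℙ.suc-homo-⁻¹ n) , sym (ℙ.suc-homo-⁻¹ n)

  parityP : Point → Parity
  parityP (x , y) = parity ∣ x ∣ ℙ.+ parity ∣ y ∣

  orientOf : Parity → Orient
  orientOf 0ℙ = vert
  orientOf 1ℙ = horiz

  orientAt : Point → Orient
  orientAt = orientOf ∘ parityP

  orientOf-⁻¹ : ∀ p → orientOf (p ⁻¹) ≡ perp (orientOf p)
  orientOf-⁻¹ 0ℙ = refl
  orientOf-⁻¹ 1ℙ = refl

  perp-perp : ∀ o → perp (perp o) ≡ o
  perp-perp vert = refl
  perp-perp horiz = refl

  parityP-step : ∀ o p → parityP (step⁺ o p) ≡ parityP p ⁻¹ × parityP (step⁻ o p) ≡ parityP p ⁻¹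
  parityP-step vert (x , y) rewrite proj₁ (parity-step y) | proj₂ (parity-step y) with parity ∣ x ∣ | parity ∣ y ∣
  ... | 0ℙ | _  = refl , refl
  ... | 1ℙ | _  = refl , refl
  parityP-step horiz (x , y) rewrite proj₁ (parity-step x) | proj₂ (parity-step x) with parity ∣ x ∣
  ... | 0ℙ  = refl , refl
  ... | 1ℙ  = sym (ℙ.⁻¹-involutive _) , sym (ℙ.⁻¹-involutive _)

  orientAt-end : ∀ {e} o c → e ∈ ends (tp c o) → orientAt e ≡ perp (orientAt c)
  orientAt-end o c e∈ with ∈-ends (tp c o) e∈
  ... | inj₁ refl = trans (cong orientOf (proj₁ (parityP-step o c))) (orientOf-⁻¹ (parityP c))
  ... | inj₂ refl = trans (cong orientOf (proj₂ (parityP-step o c))) (orientOf-⁻¹ (parityP c))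


  ==ℤ-sound : ∀ {a b} → (a ==ℤ b) ≡ true → a ≡ b
  ==ℤ-sound {a} {b} eq with yes p ← a ℤ.≟ b = p

  ==ℤ-refl : ∀ a → (a ==ℤ a) ≡ true
  ==ℤ-refl a with a ℤ.≟ a
  ... | yes _ = refl
  ... | no ¬p = contradiction refl ¬p

  ==P-sound : ∀ p q → (p ==P q) ≡ true → p ≡ q
  ==P-sound (a , b) (c , d) eq with a ==ℤ c in p | b ==ℤ d in q
  ... | true | true = cong₂ _,_ (==ℤ-sound p) (==ℤ-sound q)

  ==P-refl : ∀ p → (p ==P p) ≡ true
  ==P-refl (a , b) rewrite ==ℤ-refl a = ==ℤ-refl b

  ==T-sound : ∀ t u → (t ==T u) ≡ true → t ≡ u
  ==T-sound (tp c o) (tp c′ o′) eq with c ==P c′ in p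
  ==T-sound (tp c vert) (tp c′ vert) eq | true = cong (λ c → tp c vert) (==P-sound c c′ p)
  ==T-sound (tp c horiz) (tp c′ horiz) eq | true = cong (λ c → tp c horiz) (==P-sound c c′ p)

  ==T-refl : ∀ t → (t ==T t) ≡ true
  ==T-refl (tp c vert)  rewrite ==P-refl c = refl
  ==T-refl (tp c horiz) rewrite ==P-refl c = refl

  elemP-sound : ∀ p qs → elemP p qs ≡ true → p ∈ qs
  elemP-sound p (q ∷ qs) eq with p ==P q in pq
  ... | true  = here (==P-sound p q pq)
  ... | false = there (elemP-sound p qs eq)

  elemP-complete : ∀ {p qs} → p ∈ qs → elemP p qs ≡ true
  elemP-complete {p} (here refl) rewrite ==P-refl p = refl
  elemP-complete {p} (there {q} p∈) rewrite elemP-complete p∈ = ∨-zeroʳ (p ==P q)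

  Touches : Point → Toothpick → Set
  Touches e q = e ∈ ends q ⊎ e ≡ center q

  touches-sound : ∀ e q → touches e q ≡ true → Touches e q
  touches-sound e q eq with elemP e (ends q) in m
  ... | true  = inj₁ (elemP-sound e (ends q) m)
  ... | false = inj₂ (==P-sound e (center q) eq)

  touches-complete : ∀ {e} q → Touches e q → touches e q ≡ true
  touches-complete q (inj₁ e∈) rewrite elemP-complete e∈ = refl
  touches-complete q (inj₂ refl) rewrite ==P-refl (center q) = ∨-zeroʳ _

  exposed-sound : ∀ S t e → exposed S t e ≡ true → ∀ {q} → q ∈ S → Touches e q → q ≡ t
  exposed-sound (q ∷ S) t e eq q∈ touch with q ==T t in qt | touches e q in eq′
  exposed-sound (q ∷ S) t e eq (here refl) touch | true  | _     = ==T-sound q t qt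
  exposed-sound (q ∷ S) t e eq (here refl) touch | false | false
    = contradiction (trans (sym (touches-complete q touch)) eq′) λ ()
  exposed-sound (q ∷ S) t e eq (there q∈) touch | true  | _     = exposed-sound S t e eq q∈ touch
  exposed-sound (q ∷ S) t e eq (there q∈) touch | false | false = exposed-sound S t e eq q∈ touch

  exposed-complete : ∀ S t e → (∀ {q} → q ∈ S → Touches e q → q ≡ t) → exposed S t e ≡ true
  exposed-complete [] t e only = refl
  exposed-complete (q ∷ S) t e only with touches e q in eq
  ... | true with refl ← only (here refl) (touches-sound e q eq) rewrite ==T-refl q =
    exposed-complete S q e (only ∘ there)
  ... | false rewrite ∨-zeroʳ (q ==T t) = exposed-complete S t e (only ∘ there)

  exposed? : ∀ S t e → Dec (exposed S t e ≡ true)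
  exposed? S t e = exposed S t e Bool.≟ true

  picksAt : List Toothpick → Toothpick → List Toothpick
  picksAt S t = map (λ e → tp e (perp (orient t))) (filter (exposed? S t) (ends t))

  ∈-picksAt⁻ : ∀ S {q} t → q ∈ picksAt S t →
               center q ∈ ends t × exposed S t (center q) ≡ true × orient q ≡ perp (orient t)
  ∈-picksAt⁻ S t q∈ with e , e∈ , refl ← ∈-map⁻ _ q∈
    with e∈t , ex ← ∈-filter⁻ (exposed? S t) {xs = ends t} e∈ = e∈t , ex , refl

  ∈-picksAt⁺ : ∀ S {e} t → e ∈ ends t → exposed S t e ≡ true → tp e (perp (orient t)) ∈ picksAt S t
  ∈-picksAt⁺ S t e∈ ex = ∈-map⁺ _ (∈-filter⁺ (exposed? S t) e∈ ex)

  ∈-newPicks⁻ : ∀ S {q} → q ∈ newPicks S →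
                ∃ λ t → t ∈ S × center q ∈ ends t × exposed S t (center q) ≡ true × orient q ≡ perp (orient t)
  ∈-newPicks⁻ S q∈ with t , t∈ , q∈t ← find (∈-concatMap⁻ (picksAt S) {xs = S} q∈) = t , t∈ , ∈-picksAt⁻ S t q∈t

  ∈-newPicks⁺ : ∀ S {t e} → t ∈ S → e ∈ ends t → exposed S t e ≡ true → tp e (perp (orient t)) ∈ newPicks S
  ∈-newPicks⁺ S {t} t∈ e∈ ex = ∈-concatMap⁺ (picksAt S) (lose t∈ (∈-picksAt⁺ S t e∈ ex))

  allPairs-∈ : ∀ {A : Set} {R : A → A → Set} xs → (∀ {x y} → x ∈ xs → y ∈ xs → x ≢ y → R x y) →
               Unique xs → AllPairs R xs
  allPairs-∈ [] r [] = []
  allPairs-∈ (x ∷ xs) r (x≢ ∷ uniq) =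
    All.tabulate (λ y∈ → r (here refl) (there y∈) (All.lookup x≢ y∈)) ∷
    allPairs-∈ xs (λ x∈ y∈ → r (there x∈) (there y∈)) uniq

  -- Since `T` is a list length, repetitions would falsify the count. There are none: an exposed end
  -- touches only its own toothpick, so no point is proposed by two of them.
  newPicks-unique : ∀ {S} → Unique S → Unique (newPicks S)
  newPicks-unique {S} uniq =
    Unique.concat⁺ (All.map⁺ (All.tabulate λ {t} _ →
                     Unique.map⁺ (cong center) (Unique.filter⁺ (exposed? S t) (ends-unique t))))
                   (AllPairs.map⁺ (allPairs-∈ S disjoint uniq))
    where
    ends-unique : ∀ t → Unique (ends t)
    ends-unique t rewrite ends-step (orient t) (center t) =
      (step⁺≢step⁻ (orient t) (center t) ∷ []) ∷ [] ∷ []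
    disjoint : ∀ {t u} → t ∈ S → u ∈ S → t ≢ u → Disjoint (picksAt S t) (picksAt S u)
    disjoint {t} {u} t∈ u∈ t≢u {q} (q∈t , q∈u) =
      let _ , ex , _ = ∈-picksAt⁻ S t q∈t
          e∈u , _ = ∈-picksAt⁻ S u q∈u
      in t≢u (sym (exposed-sound S t (center q) ex u∈ (inj₁ e∈u)))

  -- A toothpick of `S` already centred at an exposed end would touch it, hence be the toothpick
  -- having that end; but no centre is an end of its own toothpick.
  step-unique : ∀ {S} → Unique S → Unique (step S)
  step-unique {S} uniq = Unique.++⁺ uniq (newPicks-unique uniq) disjoint
    where
    disjoint : Disjoint S (newPicks S)
    disjoint {q} (q∈S , q∈new) with t , t∈ , e∈ , ex , _ ← ∈-newPicks⁻ S q∈new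
      with refl ← exposed-sound S t (center q) ex q∈S (inj₂ refl) = center∉ends (orient q) (center q) e∈

  structure-unique : ∀ n → Unique (structure n)
  structure-unique zero = []
  structure-unique (suc zero) = [] ∷ []
  structure-unique (suc (suc n)) = step-unique (structure-unique (suc n))

-- Birth times describe the structure through stage `2s`.

module Stages where
  open import Data.Bool using (Bool; true; false; _∨_; _xor_)
  open import Data.Bool.Properties using (∨-zeroʳ; xor-identityʳ)
  open import Data.Maybe using (nothing)
  open import Data.Nat as ℕ using (ℕ; zero; suc; _≤_; _<_; parity)
  import Data.Nat.Properties as ℕ
  open import Data.Integer as ℤ using (ℤ; +_; ∣_∣; 0ℤ)
  import Data.Integer.Properties as ℤ
  open import Algebra.Properties.AbelianGroup ℤ.+-0-abelianGroup using () renaming (∙-cancelˡ to +-cancelˡ)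
  open import Data.List using (List; map)
  open import Data.List.Membership.Propositional using (_∈_)
  open import Data.List.Membership.Propositional.Properties
  open import Data.List.Relation.Unary.Any using (here)
  open import Data.Parity.Base using (0ℙ; 1ℙ; _⁻¹)
  import Data.Parity.Base as ℙ
  import Data.Parity.Properties as ℙ
  open import Data.Product using (_×_; _,_; proj₁; proj₂)
  open import Data.Sum using (_⊎_; inj₁; inj₂)
  import Data.Sum as Sum
  open import Data.Product.Properties using (≡-dec)
  open import Function using (_∘_)
  open import Relation.Nullary using (¬_; Dec; yes; no; contradiction)
  open import Relation.Binary.PropositionalEquality
  open BirthTimes
  open Structure

  parity-+-≡0ℙ : ∀ p q → p ℙ.+ q ≡ 0ℙ → p ≡ q
  parity-+-≡0ℙ 0ℙ 0ℙ _ = refl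
  parity-+-≡0ℙ 1ℙ 1ℙ _ = refl

  parity-+-≡1ℙ : ∀ p q → p ℙ.+ q ≡ 1ℙ → p ≡ q ⁻¹
  parity-+-≡1ℙ 0ℙ 1ℙ _ = refl
  parity-+-≡1ℙ 1ℙ 0ℙ _ = refl

  module Plane {w F} (patch : Patch w F) where
    open Patch patch
    open Glue patch using (y-axis-rule)

    horizontal-0 : ∀ y → parity 0 ≡ parity y → y ≢ 0 → F 0 y ≡ nothing
    horizontal-0 zero _ ne = contradiction refl ne
    horizontal-0 (suc (suc y)) _ _ = y-axis y

    horizontal-suc : ∀ x y → parity (suc x) ≡ parity y → ¬ (suc x ≡ s × y ≡ s) →
                     F (suc x) y ≡ F x y ⊕ F (2 ℕ.+ x) y
    horizontal-suc (suc x) zero p _ = ⊕-cong (x-axis (suc x)) (x-axis x) (x-axis (2 ℕ.+ x)) refl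
    horizontal-suc x (suc y) p ne =
      horizontal x y (parity-suc-injective x y p) (λ (q , r) → ne (cong suc q , cong suc r))

    vertical-0 : ∀ x → parity x ≡ 1ℙ → F x 0 ≡ nothing
    vertical-0 (suc x) _ = x-axis x

    vertical-suc : ∀ x y → parity x ≡ parity y → F x (suc y) ≡ F x y ⊕ F x (2 ℕ.+ y)
    vertical-suc zero y p = y-axis-rule y (sym p)
    vertical-suc (suc x) y p = vertical x y (parity-suc-cong (suc x) y p)

    birthAt : Point → Time
    birthAt (x , y) = F ∣ x ∣ ∣ y ∣

    origin-only : ∀ x y → ∣ x ∣ ≡ 0 → ∣ y ∣ ≡ 0 → (x , y) ≡ (0ℤ , 0ℤ)
    origin-only x y p q = cong₂ _,_ (ℤ.∣i∣≡0⇒i≡0 p) (ℤ.∣i∣≡0⇒i≡0 q)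

    rule-horizontal : ∀ x y → parity ∣ x ∣ ≡ parity ∣ y ∣ → (x , y) ≢ (0ℤ , 0ℤ) → ¬ (∣ x ∣ ≡ s × ∣ y ∣ ≡ s) →
                      birthAt (x , y) ≡ birthAt (x ℤ.+ + 1 , y) ⊕ birthAt (x ℤ.- + 1 , y)
    rule-horizontal x y p ne nc with ∣ x ∣-steps
    ... | inj₁ (e , e⁺ , e⁻) rewrite e | e⁺ | e⁻ =
      trans (horizontal-0 ∣ y ∣ p (λ q → ne (origin-only x y e q))) (sym (⊕-self (F 1 ∣ y ∣)))
    ... | inj₂ (inj₁ (n , e , e⁺ , e⁻)) rewrite e | e⁺ | e⁻ =
      trans (horizontal-suc n ∣ y ∣ p nc) (⊕-comm (F n ∣ y ∣) (F (2 ℕ.+ n) ∣ y ∣))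
    ... | inj₂ (inj₂ (n , e , e⁺ , e⁻)) rewrite e | e⁺ | e⁻ = horizontal-suc n ∣ y ∣ p nc

    rule-vertical : ∀ x y → parity ∣ x ∣ ≡ parity ∣ y ∣ ⁻¹ →
                    birthAt (x , y) ≡ birthAt (x , y ℤ.+ + 1) ⊕ birthAt (x , y ℤ.- + 1)
    rule-vertical x y p with ∣ y ∣-steps
    ... | inj₁ (e , e⁺ , e⁻) rewrite e | e⁺ | e⁻ =
      trans (vertical-0 ∣ x ∣ p) (sym (⊕-self (F ∣ x ∣ 1)))
    ... | inj₂ (inj₁ (n , e , e⁺ , e⁻)) rewrite e | e⁺ | e⁻ =
      trans (vertical-suc ∣ x ∣ n (trans p (ℙ.suc-homo-⁻¹ n))) (⊕-comm (F ∣ x ∣ n) (F ∣ x ∣ (2 ℕ.+ n)))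
    ... | inj₂ (inj₂ (n , e , e⁺ , e⁻)) rewrite e | e⁺ | e⁻ = vertical-suc ∣ x ∣ n (trans p (ℙ.suc-homo-⁻¹ n))

    Alive : ℕ → Point → Bool
    Alive n p = born n (birthAt p)

    source⁺ source⁻ : Point → Point
    source⁺ p = step⁺ (perp (orientAt p)) p
    source⁻ p = step⁻ (perp (orientAt p)) p

    Grows : ℕ → Point → Set
    Grows n p = Alive (suc n) p ≡ Alive n p ∨ (Alive n (source⁺ p) xor Alive n (source⁻ p))

    ⊕-grows : ∀ n {t} u v → t ≡ u ⊕ v → born (suc n) t ≡ born n t ∨ (born n u xor born n v)
    ⊕-grows n u v refl = born-suc-⊕ n u v

    -- The patch never bears its corners, whereas the structure adds them at stage `2s + 1`. Up to
    -- then there is no conflict, because the only neighbour of a corner in the patch is born at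
    -- `2s`.
    corner-grows : ∀ n x y → n < s ℕ.+ s → ∣ x ∣ ≡ s → ∣ y ∣ ≡ s →
      Alive (suc n) (x , y) ≡ Alive n (x , y) ∨ (Alive n (x ℤ.+ + 1 , y) xor Alive n (x ℤ.- + 1 , y))
    corner-grows n x y n<2s ex ey with ∣ x ∣ | ∣ x ℤ.+ + 1 ∣ | ∣ x ℤ.- + 1 ∣ | ∣ x ∣-steps
    ... | _ | _ | _ | inj₁ (refl , _) = contradiction ex λ ()
    ... | _ | _ | _ | inj₂ (inj₁ (_ , refl , refl , refl)) with refl ← ex
      rewrite ey | beyond-x {s} s ℕ.≤-refl | beyond-x {suc s} s (ℕ.n≤1+n s)
            | row-odd {w} ℕ.≤-refl (Glue.w-odd patch) = sym (not-born-> n<2s)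
    ... | _ | _ | _ | inj₂ (inj₂ (_ , refl , refl , refl)) with refl ← ex
      rewrite ey | beyond-x {s} s ℕ.≤-refl | beyond-x {suc s} s (ℕ.n≤1+n s)
            | row-odd {w} ℕ.≤-refl (Glue.w-odd patch) = sym (trans (xor-identityʳ _) (not-born-> n<2s))

    grows : ∀ n p → n < s ℕ.+ s → p ≢ (0ℤ , 0ℤ) → Grows n p
    grows n p@(x , y) n<2s ne with parityP p in eq
    ... | 1ℙ = ⊕-grows n (birthAt (x , y ℤ.+ + 1)) (birthAt (x , y ℤ.- + 1)) (rule-vertical x y (parity-+-≡1ℙ _ _ eq))
    ... | 0ℙ with ∣ x ∣ ℕ.≟ s | ∣ y ∣ ℕ.≟ s
    ...   | yes ex | yes ey = corner-grows n x y n<2s ex ey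
    ...   | no ¬ex | _      = ⊕-grows n (birthAt (x ℤ.+ + 1 , y)) (birthAt (x ℤ.- + 1 , y))
      (rule-horizontal x y (parity-+-≡0ℙ _ _ eq) ne (¬ex ∘ proj₁))
    ...   | _      | no ¬ey = ⊕-grows n (birthAt (x ℤ.+ + 1 , y)) (birthAt (x ℤ.- + 1 , y))
      (rule-horizontal x y (parity-+-≡0ℙ _ _ eq) ne (¬ey ∘ proj₂))

    record Stage (n : ℕ) (S : List Toothpick) : Set where
      field
        oriented : ∀ {t} → t ∈ S → orient t ≡ orientAt (center t)
        sound    : ∀ {t} → t ∈ S → Alive n (center t) ≡ true
        complete : ∀ p → Alive n p ≡ true → tp p (orientAt p) ∈ S

    origin? : ∀ p → Dec (p ≡ (0ℤ , 0ℤ))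
    origin? p = ≡-dec ℤ._≟_ ℤ._≟_ p (0ℤ , 0ℤ)

    -- Nothing is alive at time 0, so the growth rule at `n = 0` yields nothing away from the
    -- origin. This avoids inspecting the recursively glued birth times.
    first-alive : ∀ p → Alive 1 p ≡ true → p ≡ (0ℤ , 0ℤ)
    first-alive p al with origin? p
    ... | yes p≡0 = p≡0
    ... | no  p≢0 = contradiction (trans (sym al) (trans (grows 0 p ℕ.z<s p≢0)
      (cong₂ _∨_ (unborn p) (cong₂ _xor_ (unborn (source⁺ p)) (unborn (source⁻ p)))))) λ ()
      where
      unborn : ∀ p → Alive 0 p ≡ false
      unborn (x , y) = not-born-0 ∣ x ∣ ∣ y ∣

    -- The origin has no parent and violates the rule only at its own birth; from stage 1 on it is
    -- alive, which makes both sides true.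
    grows-suc : ∀ n p → suc n < s ℕ.+ s → Grows (suc n) p
    grows-suc n p lt with origin? p
    ... | no  p≢0  = grows (suc n) p lt p≢0
    ... | yes refl rewrite origin = refl

    stage₁ : Stage 1 (structure 1)
    stage₁ .Stage.oriented (here refl) = refl
    stage₁ .Stage.sound (here refl) rewrite origin = refl
    stage₁ .Stage.complete p al with refl ← first-alive p al = here refl

    -- Parity fixes the orientation: a toothpick ending at `e` is perpendicular to the one that
    -- could be centred at `e`, which leaves two opposite neighbours.
    ∈-sources : ∀ {e} t → orient t ≡ orientAt (center t) → e ∈ ends t →
                center t ≡ source⁺ e ⊎ center t ≡ source⁻ e
    ∈-sources {e} t ot e∈ =
      Sum.map (λ q → trans q (cong (λ o → step⁺ o e) o≡)) (λ q → trans q (cong (λ o → step⁻ o e) o≡))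
              (∈-ends (tp e (orient t)) (ends-sym t e∈))
      where
      o≡ : orient t ≡ perp (orientAt e)
      o≡ = trans (sym (perp-perp (orient t)))
             (cong perp (trans (cong perp ot) (sym (orientAt-end (orient t) (center t) e∈))))

    source⁺-end : ∀ p → p ∈ ends (tp (source⁺ p) (orientAt (source⁺ p)))
    source⁺-end p = subst (λ o → p ∈ ends (tp (source⁺ p) o)) (sym (orientAt-end o p (step⁺-∈ o p)))
      (subst (_∈ ends (tp (source⁺ p) o)) (sym (step⁻-step⁺ o p)) (step⁻-∈ o (source⁺ p)))
      where
      o = perp (orientAt p)

    source⁻-end : ∀ p → p ∈ ends (tp (source⁻ p) (orientAt (source⁻ p)))
    source⁻-end p = subst (λ o → p ∈ ends (tp (source⁻ p) o)) (sym (orientAt-end o p (step⁻-∈ o p)))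
      (subst (_∈ ends (tp (source⁻ p) o)) (sym (step⁺-step⁻ o p)) (step⁺-∈ o (source⁻ p)))
      where
      o = perp (orientAt p)

    module Next {n S} (lt : suc n < s ℕ.+ s) (stage : Stage (suc n) S) where
      open Stage stage

      alive-suc : ∀ p → Alive (suc n) p ≡ true → Alive (2 ℕ.+ n) p ≡ true
      alive-suc p = born-suc (suc n) (birthAt p)

      alive-new : ∀ p → Alive (suc n) (source⁺ p) xor Alive (suc n) (source⁻ p) ≡ true →
                  Alive (2 ℕ.+ n) p ≡ true
      alive-new p eq = trans (grows-suc n p lt) (trans (cong (Alive (suc n) p ∨_) eq) (∨-zeroʳ _))

      oriented′ : ∀ {q} → q ∈ step S → orient q ≡ orientAt (center q)
      oriented′ {q} q∈ with ∈-++⁻ S q∈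
      ... | inj₁ q∈S = oriented q∈S
      ... | inj₂ q∈new with t , t∈ , e∈ , _ , o≡ ← ∈-newPicks⁻ S q∈new =
        trans o≡ (trans (cong perp (oriented t∈)) (sym (orientAt-end (orient t) (center t) e∈)))

      lone-source : ∀ {t e} c → exposed S t e ≡ true → e ∈ ends (tp c (orientAt c)) → center t ≢ c →
                    Alive (suc n) c ≡ false
      lone-source {t} {e} c ex e∈ t≢c with Alive (suc n) c in eq
      ... | false = refl
      ... | true  = contradiction (sym (cong center (exposed-sound S t e ex (complete c eq) (inj₁ e∈)))) t≢c

      sound′ : ∀ {q} → q ∈ step S → Alive (2 ℕ.+ n) (center q) ≡ true
      sound′ {q} q∈ with ∈-++⁻ S q∈
      ... | inj₁ q∈S = alive-suc (center q) (sound q∈S)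
      ... | inj₂ q∈new with t , t∈ , e∈ , ex , _ ← ∈-newPicks⁻ S q∈new
        with ∈-sources t (oriented t∈) e∈
      ... | inj₁ c≡ = alive-new (center q) (cong₂ _xor_
        (trans (cong (Alive (suc n)) (sym c≡)) (sound t∈))
        (lone-source (source⁻ (center q)) ex (source⁻-end (center q))
          (λ c≡′ → step⁺≢step⁻ _ (center q) (trans (sym c≡) c≡′))))
      ... | inj₂ c≡ = alive-new (center q) (cong₂ _xor_
        (lone-source (source⁺ (center q)) ex (source⁺-end (center q))
          (λ c≡′ → step⁺≢step⁻ _ (center q) (trans (sym c≡′) c≡)))
        (trans (cong (Alive (suc n)) (sym c≡)) (sound t∈)))

      -- Exposure of `p` could fail in two ways. Another toothpick ending at `p` is excluded by
      -- `only`; one with midpoint `p` would mean that `p` is already alive.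
      grow : ∀ p c → Alive (suc n) p ≡ false → Alive (suc n) c ≡ true → p ∈ ends (tp c (orientAt c)) →
             (∀ {t} → t ∈ S → p ∈ ends t → center t ≡ c) → tp p (orientAt p) ∈ step S
      grow p c p-dead c-alive p∈ only =
        subst (λ o → tp p o ∈ step S) (sym (orientAt-end _ c p∈))
          (∈-++⁺ʳ S (∈-newPicks⁺ S (complete c c-alive) p∈ (exposed-complete S _ p isolated)))
        where
        isolated : ∀ {q} → q ∈ S → Touches p q → q ≡ tp c (orientAt c)
        isolated {q} q∈ (inj₁ p∈q) with refl ← only q∈ p∈q = cong (tp (center q)) (oriented q∈)
        isolated {q} q∈ (inj₂ refl) = contradiction (trans (sym p-dead) (sound q∈)) λ ()

      complete′ : ∀ p → Alive (2 ℕ.+ n) p ≡ true → tp p (orientAt p) ∈ step S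
      complete′ p al with Alive (suc n) p in p-eq | Alive (suc n) (source⁺ p) in eq⁺
                        | Alive (suc n) (source⁻ p) in eq⁻ | trans (sym (grows-suc n p lt)) al
      ... | true  | _     | _     | _ = ∈-++⁺ˡ (complete p p-eq)
      ... | false | true  | false | _ = grow p (source⁺ p) p-eq eq⁺ (source⁺-end p) only
        where
        only : ∀ {t} → t ∈ S → p ∈ ends t → center t ≡ source⁺ p
        only {t} t∈ p∈ with ∈-sources t (oriented t∈) p∈
        ... | inj₁ c≡ = c≡
        ... | inj₂ c≡ = contradiction (trans (sym eq⁻) (trans (cong (Alive (suc n)) (sym c≡)) (sound t∈))) λ ()
      ... | false | false | true  | _ = grow p (source⁻ p) p-eq eq⁻ (source⁻-end p) only
        where
        only : ∀ {t} → t ∈ S → p ∈ ends t → center t ≡ source⁻ p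
        only {t} t∈ p∈ with ∈-sources t (oriented t∈) p∈
        ... | inj₂ c≡ = c≡
        ... | inj₁ c≡ = contradiction (trans (sym eq⁺) (trans (cong (Alive (suc n)) (sym c≡)) (sound t∈))) λ ()

      next : Stage (2 ℕ.+ n) (step S)
      next = record { oriented = oriented′ ; sound = sound′ ; complete = complete′ }

    structure-stage : ∀ n → suc n ≤ s ℕ.+ s → Stage (suc n) (structure (suc n))
    structure-stage zero _ = stage₁
    structure-stage (suc n) lt = Next.next lt (structure-stage n (ℕ.<⇒≤ lt))

-- Listing and counting the points alive at a given time.

module Enumeration where
  open import Data.Bool using (true; false)
  open import Data.Maybe using (just; nothing)
  open import Data.Nat as ℕ using (ℕ; zero; suc; _≤_; _<_; z<s; _+_; _*_; _∸_; pred)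
  import Data.Nat.Properties as ℕ
  open import Data.Integer as ℤ using (ℤ; +_; -[1+_]; ∣_∣; 0ℤ; +[1+_])
  import Data.Integer.Properties as ℤ
  open import Data.List using (List; []; _∷_; map; _++_; length)
  import Data.List.Properties as List
  open import Data.List.Membership.Propositional using (_∈_)
  open import Data.List.Membership.Propositional.Properties
  open import Data.List.Membership.Propositional.Properties.WithK using (unique∧set⇒bag)
  open import Data.List.Relation.Binary.BagAndSetEquality using (∼bag⇒↭)
  open import Data.List.Relation.Binary.Permutation.Propositional.Properties using (↭-length)
  open import Data.List.Relation.Unary.Any using (here; there)
  open import Data.List.Relation.Unary.All as All using (All; []; _∷_)
  open import Data.List.Relation.Unary.AllPairs as AllPairs using ([]; _∷_)
  import Data.List.Relation.Unary.All.Properties as All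
  open import Data.List.Relation.Unary.Unique.Propositional using (Unique)
  import Data.List.Relation.Unary.Unique.Propositional.Properties as Unique
  open import Data.List.Relation.Binary.Disjoint.Propositional using (Disjoint)
  open import Data.Product using (_×_; _,_; proj₁; proj₂)
  open import Data.Sum using (inj₁; inj₂; [_,_]′)
  open import Function using (_∘_)
  open import Function.Bundles using (mk⇔)
  open import Relation.Nullary using (¬_; yes; no; contradiction)
  open import Relation.Binary.PropositionalEquality
  open ≡-Reasoning
  open BirthTimes
  open Structure
  open Stages

  born-nothing : ∀ n → born n nothing ≡ false
  born-nothing zero = refl
  born-nothing (suc n) = refl

  born-delay : ∀ n d t → born 0 t ≡ false → born n (delay d t) ≡ born (n ∸ d) t
  born-delay n zero t _ = cong (born n) (delay-zero t)
  born-delay zero (suc d) t eq = trans (not-born-0-delay (suc d) t eq) (sym eq)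
  born-delay (suc n) (suc d) nothing _ = sym (born-nothing (n ∸ d))
  born-delay (suc n) (suc d) (just a) eq = born-delay n d (just a) eq

  -- A left inverse is asked for only on the entries of the list, since the reflections use
  -- truncated subtraction and are not injective everywhere.
  unique-map : ∀ {A B : Set} {f : A → B} (g : B → A) {xs} → (∀ {x} → x ∈ xs → g (f x) ≡ x) →
               Unique xs → Unique (map f xs)
  unique-map g {xs} inverse uniq =
    Unique.map⁻ {f = g}
      (subst Unique (sym (trans (sym (List.map-∘ xs)) (List.map-id-local (All.tabulate inverse)))) uniq)

  disjoint-by : ∀ {A : Set} {P Q : A → Set} {xs ys} → All P xs → All Q ys → (∀ {x} → P x → ¬ Q x) → Disjoint xs ys
  disjoint-by ps qs clash (x∈xs , x∈ys) = clash (All.lookup ps x∈xs) (All.lookup qs x∈ys)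

  -- Only points off the axes are listed, so that the four reflected quadrants, and likewise the
  -- reflected copies in a glued patch, never share a point.
  record Enumerates (F : ℕ → ℕ → Time) (n : ℕ) (L : List (ℕ × ℕ)) : Set where
    field
      unique   : Unique L
      sound    : ∀ {x y} → (x , y) ∈ L → 0 < x × 0 < y × born n (F x y) ≡ true
      complete : ∀ x y → born n (F (suc x) (suc y)) ≡ true → (suc x , suc y) ∈ L

  axis : ℕ → List (ℕ × ℕ)
  axis 0 = []
  axis 1 = (0 , 0) ∷ []
  axis _ = (0 , 0) ∷ (0 , 1) ∷ []

  -- The axis shared by the two upper copies is listed once, on the right. The axis points of the
  -- turned copy, `(s-1 , s)` and `(s , s)`, are already listed in the old block and in the upper
  -- right copy. The listed `u` are positive, so `pred u` loses nothing.
  glueList : ℕ → (ℕ → List (ℕ × ℕ)) → ℕ → List (ℕ × ℕ)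
  glueList s Q n =
       Q n
    ++ map (λ (u , v) → s ∸ u , v + s) (Q (n ∸ (s + s)))
    ++ map (λ (u , v) → u + s , v + s) (axis (n ∸ (s + s)) ++ Q (n ∸ (s + s)))
    ++ map (λ (v , u) → pred u + s , s ∸ v) (Q (n ∸ (pred s + s)))

  axis-x : ∀ n {x y} → (x , y) ∈ axis n → x ≡ 0
  axis-x 1 (here refl) = refl
  axis-x (suc (suc n)) (here refl) = refl
  axis-x (suc (suc n)) (there (here refl)) = refl

  axis-unique : ∀ n → Unique (axis n)
  axis-unique 0 = []
  axis-unique 1 = [] ∷ []
  axis-unique (suc (suc n)) = ((λ ()) ∷ []) ∷ [] ∷ []

  module GlueList {w F} (patch : Patch w F) (Q : ℕ → List (ℕ × ℕ)) (lists : ∀ n → Enumerates F n (Q n)) where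
    open Patch patch
    open Glue patch
    module L n = Enumerates (lists n)

    axis-sound : ∀ n {x y} → (x , y) ∈ axis n → born n (F x y) ≡ true
    axis-sound 1 (here refl) rewrite origin = refl
    axis-sound (suc (suc n)) (here refl) rewrite origin = refl
    axis-sound (suc (suc n)) (there (here refl)) rewrite above = refl

    axis-complete : ∀ n y → born n (F 0 y) ≡ true → (0 , y) ∈ axis n
    axis-complete n 0 al with n | subst (λ t → born n t ≡ true) origin al
    ... | 1 | _ = here refl
    ... | suc (suc n) | _ = here refl
    axis-complete n 1 al with n | subst (λ t → born n t ≡ true) above al
    ... | suc zero | ()
    ... | suc (suc n) | _ = there (here refl)
    axis-complete n (suc (suc y)) al rewrite y-axis y = contradiction al λ ()

    bounds : ∀ n {x y} → born n (F x y) ≡ true → x < s × y ≤ s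
    bounds n {x} {y} al with x ℕ.<? s | y ℕ.≤? s
    ... | yes x<s | yes y≤s = x<s , y≤s
    ... | no  x≮s | _       = contradiction (trans (sym al) (cong (born n) (beyond-x y (ℕ.≮⇒≥ x≮s)))) λ ()
    ... | _       | no  y≰s = contradiction (trans (sym al) (cong (born n) (beyond-y x (ℕ.≰⇒> y≰s)))) λ ()

    born-glue : ∀ n d {t} u v → t ≡ delay d (F u v) → born n t ≡ born (n ∸ d) (F u v)
    born-glue n d u v eq = trans (cong (born n) eq) (born-delay n d (F u v) (not-born-0 u v))

    UL UR BR : ℕ × ℕ → ℕ × ℕ
    UL (u , v) = s ∸ u , v + s
    UR (u , v) = u + s , v + s
    BR (v , u) = pred u + s , s ∸ v

    InQ InUL InUR InBR : ℕ × ℕ → Set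
    InQ  (x , y) = x < s × y ≤ s
    InUL (x , y) = x < s × s < y
    InUR (x , y) = s ≤ x × s ≤ y
    InBR (x , y) = s ≤ x × y < s

    Q-in : ∀ n → All InQ (Q n)
    Q-in n = All.tabulate λ q∈ → bounds n (proj₂ (proj₂ (L.sound n q∈)))

    UL-in : ∀ n → All InUL (map UL (Q n))
    UL-in n = All.map⁺ (All.tabulate λ q∈ → let 0<u , 0<v , al = L.sound n q∈ in
      ℕ.∸-monoʳ-< 0<u (ℕ.<⇒≤ (proj₁ (bounds n al))) , ℕ.+-monoˡ-< s 0<v)

    UR-in : ∀ n → All InUR (map UR (axis n ++ Q n))
    UR-in n = All.map⁺ (All.tabulate λ {(u , v)} _ → ℕ.m≤n+m s u , ℕ.m≤n+m s v)

    BR-in : ∀ n → All InBR (map BR (Q n))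
    BR-in n = All.map⁺ (All.tabulate λ {(v , u)} q∈ → let 0<v , _ , al = L.sound n q∈ in
      ℕ.m≤n+m s (pred u) , ℕ.∸-monoʳ-< 0<v (ℕ.<⇒≤ (proj₁ (bounds n al))))

    UL-unique : ∀ n → Unique (map UL (Q n))
    UL-unique n = unique-map (λ (x , y) → s ∸ x , y ∸ s)
      (λ {(u , v)} q∈ → cong₂ _,_ (ℕ.m∸[m∸n]≡n (ℕ.<⇒≤ (proj₁ (All.lookup (Q-in n) q∈)))) (ℕ.m+n∸n≡m v s)) (L.unique n)

    UR-unique : ∀ n → Unique (map UR (axis n ++ Q n))
    UR-unique n = unique-map (λ (x , y) → x ∸ s , y ∸ s)
      (λ {(u , v)} _ → cong₂ _,_ (ℕ.m+n∸n≡m u s) (ℕ.m+n∸n≡m v s))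
      (Unique.++⁺ (axis-unique n) (L.unique n)
        λ (a∈ , q∈) → ℕ.<⇒≢ (proj₁ (L.sound n q∈)) (sym (axis-x n a∈)))

    BR-unique : ∀ n → Unique (map BR (Q n))
    BR-unique n = unique-map (λ (x , y) → s ∸ y , suc (x ∸ s)) inverse (L.unique n)
      where
      inverse : ∀ {q} → q ∈ Q n → (s ∸ proj₂ (BR q) , suc (proj₁ (BR q) ∸ s)) ≡ q
      inverse {v , zero} q∈ with () ← proj₁ (proj₂ (L.sound n q∈))
      inverse {v , suc u} q∈ =
        cong₂ _,_ (ℕ.m∸[m∸n]≡n (ℕ.<⇒≤ (proj₁ (All.lookup (Q-in n) q∈)))) (cong suc (ℕ.m+n∸n≡m u s))

    glue-lists : ∀ n → Enumerates G n (glueList s Q n)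
    glue-lists n = record { unique = unique′ ; sound = sound′ ; complete = complete′ }
      where
      n₁ = n ∸ (s + s)
      n₂ = n ∸ (w + s)
      unique′ : Unique (glueList s Q n)
      unique′ =
        Unique.++⁺ (L.unique n)
          (Unique.++⁺ (UL-unique n₁)
            (Unique.++⁺ (UR-unique n₁) (BR-unique n₂)
              (disjoint-by (UR-in n₁) (BR-in n₂) λ (_ , s≤y) (_ , y<s) → ℕ.<⇒≱ y<s s≤y))
            (disjoint-by (UL-in n₁) (All.++⁺ (All.map proj₁ (UR-in n₁)) (All.map proj₁ (BR-in n₂)))
              λ (x<s , _) s≤x → ℕ.<⇒≱ x<s s≤x))
          (disjoint-by (Q-in n)
            (All.++⁺ (All.map (λ (_ , s<y) (_ , y≤s) → ℕ.<⇒≱ s<y y≤s) (UL-in n₁))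
              (All.++⁺ (All.map right (UR-in n₁)) (All.map right (BR-in n₂))))
            λ in-Q ¬in-Q → ¬in-Q in-Q)
        where
        right : ∀ {q} {R : Set} → s ≤ proj₁ q × R → ¬ InQ q
        right (s≤x , _) (x<s , _) = ℕ.<⇒≱ x<s s≤x
      sound′ : ∀ {x y} → (x , y) ∈ glueList s Q n → 0 < x × 0 < y × born n (G x y) ≡ true
      sound′ q∈ with ∈-++⁻ (Q n) q∈
      ... | inj₁ q∈Q = let 0<x , 0<y , al = L.sound n q∈Q ; x<s , y≤s = bounds n al in
        0<x , 0<y , trans (cong (born n) (low x<s y≤s)) al
      ... | inj₂ q∈′ with ∈-++⁻ (map UL (Q n₁)) q∈′
      ...   | inj₁ q∈UL with ∈-map⁻ UL q∈UL
      ...     | (u , zero) , p∈ , refl with () ← proj₁ (proj₂ (L.sound n₁ p∈))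
      sound′ q∈ | inj₂ q∈′ | inj₁ q∈UL | (u , suc v) , p∈ , refl =
        let _ , _ , al = L.sound n₁ p∈ ; u<s = proj₁ (bounds n₁ al) in
        ℕ.m<n⇒0<n∸m u<s , z<s ,
        trans (born-glue n (s + s) u (suc v) (ul u v (ℕ.m+[n∸m]≡n (ℕ.<⇒≤ u<s)) refl)) al
      sound′ q∈ | inj₂ q∈′ | inj₂ q∈″ with ∈-++⁻ (map UR (axis n₁ ++ Q n₁)) q∈″
      ...   | inj₁ q∈UR with (u , v) , p∈ , refl ← ∈-map⁻ UR q∈UR =
        ℕ.≤-trans z<s (ℕ.m≤n+m s u) , ℕ.≤-trans z<s (ℕ.m≤n+m s v) ,
        trans (born-glue n (s + s) u v (ur u v refl refl))
              ([ axis-sound n₁ , proj₂ ∘ proj₂ ∘ L.sound n₁ ]′ (∈-++⁻ (axis n₁) p∈))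
      ...   | inj₂ q∈BR with ∈-map⁻ BR q∈BR
      ...     | (v , zero) , p∈ , refl with () ← proj₁ (proj₂ (L.sound n₂ p∈))
      sound′ q∈ | inj₂ q∈′ | inj₂ q∈″ | inj₂ q∈BR | (v , suc u) , p∈ , refl =
        let _ , _ , al = L.sound n₂ p∈ ; v<s = proj₁ (bounds n₂ al) in
        ℕ.≤-trans z<s (ℕ.m≤n+m s u) , ℕ.m<n⇒0<n∸m v<s ,
        trans (born-glue n (w + s) v (suc u) (br u v refl (ℕ.m+[n∸m]≡n (ℕ.<⇒≤ v<s)))) al
      complete′ : ∀ x y → born n (G (suc x) (suc y)) ≡ true → (suc x , suc y) ∈ glueList s Q n
      complete′ x y al with across (suc x) | across (suc y)
      ... | near u e | near v f =
        ∈-++⁺ˡ (L.complete n x y (trans (cong (born n) (sym (low (near-< e) (ℕ.<⇒≤ (near-< f))))) al))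
      ... | near u e | far zero refl =
        ∈-++⁺ˡ (L.complete n x y (trans (cong (born n) (sym (low (near-< e) ℕ.≤-refl))) al))
      ... | near u e | far (suc v) refl =
        ∈-++⁺ʳ (Q n) (∈-++⁺ˡ (subst (_∈ map UL (Q n₁)) (cong (_, suc v + s) x≡)
          (∈-map⁺ UL (L.complete n₁ u v (trans (sym (born-glue n (s + s) (suc u) (suc v) (ul (suc u) v e refl))) al)))))
        where
        x≡ : s ∸ suc u ≡ suc x
        x≡ = trans (cong (_∸ suc u) (sym e)) (ℕ.m+n∸m≡n (suc u) (suc x))
      ... | far u e | near v f =
        ∈-++⁺ʳ (Q n) (∈-++⁺ʳ (map UL (Q n₁)) (∈-++⁺ʳ (map UR (axis n₁ ++ Q n₁))
          (subst (_∈ map BR (Q n₂)) (cong₂ _,_ (sym e) y≡)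
            (∈-map⁺ BR (L.complete n₂ v u (trans (sym (born-glue n (w + s) (suc v) (suc u) (br u (suc v) e f))) al))))))
        where
        y≡ : s ∸ suc v ≡ suc y
        y≡ = trans (cong (_∸ suc v) (sym f)) (ℕ.m+n∸m≡n (suc v) (suc y))
      ... | far u e | far v f =
        ∈-++⁺ʳ (Q n) (∈-++⁺ʳ (map UL (Q n₁)) (∈-++⁺ˡ
          (subst (_∈ map UR (axis n₁ ++ Q n₁)) (cong₂ _,_ (sym e) (sym f))
            (∈-map⁺ UR (corner u v (trans (sym (born-glue n (s + s) u v (ur u v e f))) al))))))
        where
        corner : ∀ u v → born n₁ (F u v) ≡ true → (u , v) ∈ axis n₁ ++ Q n₁
        corner zero v al = ∈-++⁺ˡ (axis-complete n₁ v al)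
        corner (suc u) zero al = contradiction (trans (sym al) (cong (born n₁) (x-axis u))) λ ()
        corner (suc u) (suc v) al = ∈-++⁺ʳ (axis n₁) (L.complete n₁ u v al)

  quadrant₀ : ℕ → List (ℕ × ℕ)
  quadrant₀ 3 = (1 , 1) ∷ []
  quadrant₀ (suc (suc (suc (suc n)))) = (1 , 1) ∷ (1 , 2) ∷ []
  quadrant₀ _ = []

  quadrant₀-lists : ∀ n → Enumerates F₀ n (quadrant₀ n)
  quadrant₀-lists 0 = record { unique = [] ; sound = λ () ; complete = λ { 0 0 () ; 0 1 () } }
  quadrant₀-lists 1 = record { unique = [] ; sound = λ () ; complete = λ { 0 0 () ; 0 1 () } }
  quadrant₀-lists 2 = record { unique = [] ; sound = λ () ; complete = λ { 0 0 () ; 0 1 () } }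
  quadrant₀-lists 3 = record
    { unique   = [] ∷ []
    ; sound    = λ { (here refl) → z<s , z<s , refl }
    ; complete = λ { 0 0 _ → here refl ; 0 1 () }
    }
  quadrant₀-lists (suc (suc (suc (suc _)))) = record
    { unique   = ((λ ()) ∷ []) ∷ [] ∷ []
    ; sound    = λ { (here refl) → z<s , z<s , refl ; (there (here refl)) → z<s , z<s , refl }
    ; complete = λ { 0 0 _ → here refl ; 0 1 _ → there (here refl) }
    }

  quadrant : ℕ → ℕ → List (ℕ × ℕ)
  quadrant zero    = quadrant₀
  quadrant (suc k) = glueList (suc (width k)) (quadrant k)

  quadrant-lists : ∀ k n → Enumerates (birth k) n (quadrant k n)
  quadrant-lists zero    = quadrant₀-lists
  quadrant-lists (suc k) = GlueList.glue-lists (birth-patch k) (quadrant k) (quadrant-lists k)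

  signed : (ℕ → ℤ) → (ℕ → ℤ) → ℕ × ℕ → Point
  signed f g (x , y) = f x , g y

  pos neg : ℕ → ℤ
  pos n = + n
  neg n = ℤ.- + n

  planeList : List (ℕ × ℕ) → List Point
  planeList L = (0ℤ , 0ℤ) ∷ (0ℤ , + 1) ∷ (0ℤ , -[1+ 0 ]) ∷
    (map (signed pos pos) L ++ map (signed pos neg) L ++ map (signed neg pos) L ++ map (signed neg neg) L)

  length-planeList : ∀ L → length (planeList L) ≡ 3 + 4 * length L
  length-planeList L
    rewrite List.length-++ (map (signed pos pos) L)
              {map (signed pos neg) L ++ map (signed neg pos) L ++ map (signed neg neg) L}
          | List.length-++ (map (signed pos neg) L) {map (signed neg pos) L ++ map (signed neg neg) L}
          | List.length-++ (map (signed neg pos) L) {map (signed neg neg) L}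
          | List.length-map (signed pos pos) L | List.length-map (signed pos neg) L
          | List.length-map (signed neg pos) L | List.length-map (signed neg neg) L
    = cong (λ m → 3 + (length L + (length L + (length L + m)))) (sym (ℕ.+-identityʳ (length L)))

  data Pos : ℤ → Set where
    positive : ∀ n → Pos +[1+ n ]

  data Neg : ℤ → Set where
    negative : ∀ n → Neg -[1+ n ]

  pos-Pos : ∀ {n} → 0 < n → Pos (pos n)
  pos-Pos {suc n} _ = positive n

  neg-Neg : ∀ {n} → 0 < n → Neg (neg n)
  neg-Neg {suc n} _ = negative n

  Pos≢Neg : ∀ {i} → Pos i → ¬ Neg i
  Pos≢Neg (positive _) ()

  module PlaneList {w F} (patch : Patch w F) {n L} (2≤n : 2 ≤ n) (lists : Enumerates F n L) where
    open Patch patch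
    open Plane patch
    open Enumerates lists

    signed-in : ∀ f g {P Q : ℤ → Set} → (∀ {n} → 0 < n → P (f n)) → (∀ {n} → 0 < n → Q (g n)) →
                All (λ p → P (proj₁ p) × Q (proj₂ p)) (map (signed f g) L)
    signed-in f g p q = All.map⁺ (All.tabulate λ xy∈ → let 0<x , 0<y , _ = sound xy∈ in p 0<x , q 0<y)

    abs-neg : ∀ n → ∣ neg n ∣ ≡ n
    abs-neg n = ℤ.∣-i∣≡∣i∣ (+ n)

    signed-unique : ∀ f g → (∀ n → ∣ f n ∣ ≡ n) → (∀ n → ∣ g n ∣ ≡ n) → Unique (map (signed f g) L)
    signed-unique f g ff gg = unique-map (λ (x , y) → ∣ x ∣ , ∣ y ∣) (λ {(x , y)} _ → cong₂ _,_ (ff x) (gg y)) unique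

    signed-sound : ∀ f g → (∀ n → ∣ f n ∣ ≡ n) → (∀ n → ∣ g n ∣ ≡ n) →
                   ∀ {p} → p ∈ map (signed f g) L → Alive n p ≡ true
    signed-sound f g ff gg p∈ with (x , y) , xy∈ , refl ← ∈-map⁻ (signed f g) p∈ rewrite ff x | gg y =
      proj₂ (proj₂ (sound xy∈))

    off-axes : All (λ p → proj₁ p ≢ 0ℤ)
      (map (signed pos pos) L ++ map (signed pos neg) L ++ map (signed neg pos) L ++ map (signed neg neg) L)
    off-axes =
      All.++⁺ (All.map (Pos≢0 ∘ proj₁) (signed-in pos pos {Pos} {Pos} pos-Pos pos-Pos))
        (All.++⁺ (All.map (Pos≢0 ∘ proj₁) (signed-in pos neg {Pos} {Neg} pos-Pos neg-Neg))
          (All.++⁺ (All.map (Neg≢0 ∘ proj₁) (signed-in neg pos {Neg} {Pos} neg-Neg pos-Pos))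
                   (All.map (Neg≢0 ∘ proj₁) (signed-in neg neg {Neg} {Neg} neg-Neg neg-Neg))))
      where
      Pos≢0 : ∀ {i} → Pos i → i ≢ 0ℤ
      Pos≢0 (positive _) ()
      Neg≢0 : ∀ {i} → Neg i → i ≢ 0ℤ
      Neg≢0 (negative _) ()

    planeList-unique : Unique (planeList L)
    planeList-unique =
      ((λ ()) ∷ (λ ()) ∷ All.map (λ ne → ne ∘ sym ∘ cong proj₁) off-axes) ∷
      ((λ ()) ∷ All.map (λ ne → ne ∘ sym ∘ cong proj₁) off-axes) ∷
      All.map (λ ne → ne ∘ sym ∘ cong proj₁) off-axes ∷
      Unique.++⁺ (signed-unique pos pos (λ _ → refl) (λ _ → refl))
        (Unique.++⁺ (signed-unique pos neg (λ _ → refl) abs-neg)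
          (Unique.++⁺ (signed-unique neg pos abs-neg (λ _ → refl)) (signed-unique neg neg abs-neg abs-neg)
            (disjoint-by (signed-in neg pos {Neg} {Pos} neg-Neg pos-Pos) (signed-in neg neg {Neg} {Neg} neg-Neg neg-Neg)
              λ (_ , p) (_ , q) → Pos≢Neg p q))
          (disjoint-by (All.map proj₁ (signed-in pos neg {Pos} {Neg} pos-Pos neg-Neg))
            (All.++⁺ (All.map proj₁ (signed-in neg pos {Neg} {Pos} neg-Neg pos-Pos))
                     (All.map proj₁ (signed-in neg neg {Neg} {Neg} neg-Neg neg-Neg)))
            Pos≢Neg))
        (disjoint-by (signed-in pos pos {Pos} {Pos} pos-Pos pos-Pos)
          (All.++⁺ (All.map (λ (_ , q) (_ , p) → Pos≢Neg p q) (signed-in pos neg {Pos} {Neg} pos-Pos neg-Neg))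
            (All.++⁺ (All.map (λ (q , _) (p , _) → Pos≢Neg p q) (signed-in neg pos {Neg} {Pos} neg-Neg pos-Pos))
                     (All.map (λ (q , _) (p , _) → Pos≢Neg p q) (signed-in neg neg {Neg} {Neg} neg-Neg neg-Neg))))
          λ p ¬p → ¬p p)

    planeList-sound : ∀ {p} → p ∈ planeList L → Alive n p ≡ true
    planeList-sound (here refl) rewrite origin = born-≤ (ℕ.<⇒≤ 2≤n)
    planeList-sound (there (here refl)) rewrite above = born-≤ 2≤n
    planeList-sound (there (there (here refl))) rewrite above = born-≤ 2≤n
    planeList-sound (there (there (there p∈))) with ∈-++⁻ (map (signed pos pos) L) p∈
    ... | inj₁ p∈₁ = signed-sound pos pos (λ _ → refl) (λ _ → refl) p∈₁
    ... | inj₂ p∈₂ with ∈-++⁻ (map (signed pos neg) L) p∈₂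
    ...   | inj₁ p∈₃ = signed-sound pos neg (λ _ → refl) abs-neg p∈₃
    ...   | inj₂ p∈₄ with ∈-++⁻ (map (signed neg pos) L) p∈₄
    ...     | inj₁ p∈₅ = signed-sound neg pos abs-neg (λ _ → refl) p∈₅
    ...     | inj₂ p∈₆ = signed-sound neg neg abs-neg abs-neg p∈₆

    dead : ∀ {A : Set} {t} → t ≡ nothing → born n t ≡ true → A
    dead refl al = contradiction (trans (sym al) (born-nothing n)) λ ()

    planeList-complete : ∀ p → Alive n p ≡ true → p ∈ planeList L
    planeList-complete (+ 0 , + 0) al = here refl
    planeList-complete (+ 0 , + 1) al = there (here refl)
    planeList-complete (+ 0 , -[1+ 0 ]) al = there (there (here refl))
    planeList-complete (+ 0 , + (suc (suc y))) al = dead (y-axis y) al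
    planeList-complete (+ 0 , -[1+ suc y ]) al = dead (y-axis y) al
    planeList-complete (+[1+ x ] , + 0) al = dead (x-axis x) al
    planeList-complete (-[1+ x ] , + 0) al = dead (x-axis x) al
    planeList-complete (+[1+ x ] , +[1+ y ]) al =
      there (there (there (∈-++⁺ˡ (∈-map⁺ (signed pos pos) (complete x y al)))))
    planeList-complete (+[1+ x ] , -[1+ y ]) al =
      there (there (there (∈-++⁺ʳ (map (signed pos pos) L) (∈-++⁺ˡ (∈-map⁺ (signed pos neg) (complete x y al))))))
    planeList-complete (-[1+ x ] , +[1+ y ]) al =
      there (there (there (∈-++⁺ʳ (map (signed pos pos) L) (∈-++⁺ʳ (map (signed pos neg) L)
        (∈-++⁺ˡ (∈-map⁺ (signed neg pos) (complete x y al)))))))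
    planeList-complete (-[1+ x ] , -[1+ y ]) al =
      there (there (there (∈-++⁺ʳ (map (signed pos pos) L) (∈-++⁺ʳ (map (signed pos neg) L)
        (∈-++⁺ʳ (map (signed neg pos) L) (∈-map⁺ (signed neg neg) (complete x y al)))))))

    -- Two lists without repetitions and with the same members are permutations of each other, so
    -- the order in which the structure lists its toothpicks is irrelevant.
    stage-length : ∀ {S} → Unique S → Stage n S → length S ≡ 3 + 4 * length L
    stage-length {S} S-unique stage =
      trans (↭-length (∼bag⇒↭ (unique∧set⇒bag S-unique (Unique.map⁺ (cong center) planeList-unique) (mk⇔ to from))))
            (trans (List.length-map pick (planeList L)) (length-planeList L))
      where
      module S = Stage stage
      pick : Point → Toothpick
      pick p = tp p (orientAt p)
      to : ∀ {t} → t ∈ S → t ∈ map pick (planeList L)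
      to {t} t∈ = subst (_∈ map pick (planeList L)) (cong (tp (center t)) (sym (S.oriented t∈)))
                        (∈-map⁺ pick (planeList-complete (center t) (S.sound t∈)))
      from : ∀ {t} → t ∈ map pick (planeList L) → t ∈ S
      from t∈ with p , p∈ , refl ← ∈-map⁻ pick t∈ = S.complete p (planeList-sound p∈)

  count : ℕ → ℕ → ℕ
  count k n = length (quadrant k n)

  -- The lower bound on `n` is there because the three points of the axis are all present only from
  -- stage 2 on; the upper bound is the horizon of the patch, set by its missing corners.
  T-count : ∀ k n → 2 ≤ n → n ≤ suc (width k) + suc (width k) → T n ≡ 3 + 4 * count k n
  T-count k (suc n) 2≤n n≤2s =
    PlaneList.stage-length (birth-patch k) 2≤n (quadrant-lists k (suc n)) (structure-unique (suc n))
      (Plane.structure-stage (birth-patch k) n n≤2s)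

  count-suc : ∀ k n → let s = suc (width k) in
    count (suc k) n ≡ count k n + (count k (n ∸ (s + s)) + ((length (axis (n ∸ (s + s))) + count k (n ∸ (s + s)))
                        + count k (n ∸ (width k + s))))
  count-suc k n = begin
    length (q ++ map UL q₁ ++ map UR (a ++ q₁) ++ map BR q₂)
      ≡⟨ List.length-++ q ⟩
    length q + length (map UL q₁ ++ map UR (a ++ q₁) ++ map BR q₂)
      ≡⟨ cong (λ m → length q + m) (List.length-++ (map UL q₁)) ⟩
    length q + (length (map UL q₁) + length (map UR (a ++ q₁) ++ map BR q₂))
      ≡⟨ cong (λ m → length q + (length (map UL q₁) + m)) (List.length-++ (map UR (a ++ q₁))) ⟩
    length q + (length (map UL q₁) + (length (map UR (a ++ q₁)) + length (map BR q₂)))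
      ≡⟨ cong₂ (λ l m → length q + (l + m)) (List.length-map UL q₁)
               (cong₂ _+_ (trans (List.length-map UR (a ++ q₁)) (List.length-++ a)) (List.length-map BR q₂)) ⟩
    length q + (length q₁ + ((length a + length q₁) + length q₂)) ∎
    where
    s = suc (width k)
    open GlueList (birth-patch k) (quadrant k) (quadrant-lists k) using (UL; UR; BR)
    q = quadrant k n
    q₁ = quadrant k (n ∸ (s + s))
    q₂ = quadrant k (n ∸ (width k + s))
    a = axis (n ∸ (s + s))

-- The recurrence for `T` and the deficit.

module Recurrence where
  open import Data.Nat
  open import Data.Nat.Properties
  open import Data.Nat.Tactic.RingSolver using (solve-∀)
  open import Data.List using (length)
  open import Data.Product using (_×_; _,_; Σ)
  open import Relation.Nullary using (yes; no; contradiction)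
  open import Relation.Binary.PropositionalEquality
  open ≡-Reasoning
  open BirthTimes using (width)
  open Enumeration

  span : ℕ → ℕ
  span k = suc (width k) + suc (width k)

  4≤span : ∀ k → 4 ≤ span k
  4≤span zero    = ≤-refl
  4≤span (suc k) = ≤-trans (4≤span k) (m≤m+n (span k) (span k))

  count-small : ∀ k n → n ≤ 2 → count k n ≡ 0
  count-small zero 0 _ = refl
  count-small zero 1 _ = refl
  count-small zero 2 _ = refl
  count-small zero (suc (suc (suc _))) (s≤s (s≤s ()))
  count-small (suc k) n n≤2
    rewrite count-suc k n
          | m≤n⇒m∸n≡0 (≤-trans n≤2 (≤-trans (s≤s (s≤s z≤n)) (4≤span k)))
          | m≤n⇒m∸n≡0 (≤-trans n≤2 (≤-trans (s≤s (s≤s z≤n)) (s≤s⁻¹ (4≤span k))))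
          | count-small k n n≤2 | count-small k 0 z≤n = refl

  -- The copies restart at time `span k`, except that the turned one is one stage ahead, whence
  -- `suc i`.
  count-after : ∀ k i → count (suc k) (span k + i) ≡
    count k (span k + i) + (count k i + ((length (axis i) + count k i) + count k (suc i)))
  count-after k i
    rewrite count-suc k (span k + i) | m+n∸m≡n (span k) i
          | sym (+-suc (width k + suc (width k)) i) | m+n∸m≡n (width k + suc (width k)) (suc i) = refl

  axis-full : ∀ n → 2 ≤ n → length (axis n) ≡ 2
  axis-full (suc (suc n)) _ = refl
  axis-full 1 (s≤s ())

  -- From time `span k` on the patch is complete, and its number of points obeys `c' = 4c + 2`, the
  -- 2 coming from the axis above the corner. Hence `3c + 2` quadruples when `s` doubles. The slack
  -- `j` serves the induction, which evaluates the smaller patch at several times past its span.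
  count-full : ∀ k j → let s = suc (width k) in 3 * count k (span k + j) + 2 ≡ 2 * (s * s)
  count-full zero j = refl
  count-full (suc k) j = begin
    3 * count (suc k) (m + m + j) + 2
      ≡⟨ cong (λ n → 3 * count (suc k) n + 2) (+-assoc m m j) ⟩
    3 * count (suc k) (m + (m + j)) + 2
      ≡⟨ cong (λ c → 3 * c + 2) (count-after k (m + j)) ⟩
    3 * (a + (b + ((length (axis (m + j)) + b) + d))) + 2
      ≡⟨ cong (λ l → 3 * (a + (b + ((l + b) + d))) + 2) 
              (axis-full (m + j) (≤-trans (s≤s (s≤s z≤n)) (≤-trans (4≤span k) (m≤m+n m j)))) ⟩
    3 * (a + (b + ((2 + b) + d))) + 2
      ≡⟨ regroup a b d ⟩
    (3 * a + 2) + 2 * (3 * b + 2) + (3 * d + 2)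
      ≡⟨ cong₂ _+_ (cong₂ (λ p q → p + 2 * q) (count-full k (m + j)) (count-full k j))
                   (trans (cong (λ n → 3 * count k n + 2) (sym (+-suc m j))) (count-full k (suc j))) ⟩
    2 * (s * s) + 2 * (2 * (s * s)) + 2 * (s * s)
      ≡⟨ quadruple s ⟩
    2 * (m * m) ∎
    where
    s = suc (width k)
    m = span k
    a = count k (m + (m + j))
    b = count k (m + j)
    d = count k (suc (m + j))
    regroup : ∀ a b d → 3 * (a + (b + ((2 + b) + d))) + 2 ≡ (3 * a + 2) + 2 * (3 * b + 2) + (3 * d + 2)
    regroup = solve-∀
    quadruple : ∀ s → 2 * (s * s) + 2 * (2 * (s * s)) + 2 * (s * s) ≡ 2 * ((s + s) * (s + s))
    quadruple = solve-∀

  count-span : ∀ k → let s = suc (width k) in 3 * count k (span k) + 2 ≡ 2 * (s * s)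
  count-span k = trans (cong (λ n → 3 * count k n + 2) (sym (+-identityʳ (span k)))) (count-full k 0)

  count-plateau : ∀ k j → count k (span k + j) ≡ count k (span k)
  count-plateau k j = *-cancelˡ-≡ _ _ 3 (+-cancelʳ-≡ 2 _ _
    (trans (count-full k j) (sym (count-span k))))

  T-span : ∀ k → 3 * T (span k) ≡ 2 * (span k * span k) + 1
  T-span k = begin
    3 * T m                    ≡⟨ cong (3 *_) (T-count k m (≤-trans (s≤s (s≤s z≤n)) (4≤span k)) ≤-refl) ⟩
    3 * (3 + 4 * c)            ≡⟨ regroup c ⟩
    4 * (3 * c + 2) + 1        ≡⟨ cong (λ z → 4 * z + 1) (count-span k) ⟩
    4 * (2 * (s * s)) + 1      ≡⟨ quadruple s ⟩
    2 * (m * m) + 1            ∎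
    where
    s = suc (width k)
    m = span k
    c = count k m
    regroup : ∀ c → 3 * (3 + 4 * c) ≡ 4 * (3 * c + 2) + 1
    regroup = solve-∀
    quadruple : ∀ s → 4 * (2 * (s * s)) + 1 ≡ 2 * ((s + s) * (s + s)) + 1
    quadruple = solve-∀

  -- For `i ≥ 2` the four terms `3 + 4 * count` on the right bring the constant 12. On the left
  -- there are 3 axis points and two further axis points in each of four quadrants, 11 in all; this
  -- is the `+ 1`.
  T-recurrence : ∀ k i → 1 ≤ i → i < span k → T (span k + i) + 1 ≡ T (span k) + 2 * T i + T (suc i)
  T-recurrence k i 1≤i i<m = begin
    T (m + i) + 1
      ≡⟨ cong (_+ 1) (T-count (suc k) (m + i) (≤-trans 2≤m (m≤m+n m i)) (+-monoʳ-≤ m (<⇒≤ i<m))) ⟩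
    3 + 4 * count (suc k) (m + i) + 1
      ≡⟨ cong (λ c → 3 + 4 * c + 1) (trans (count-after k i)
           (cong (_+ (count k i + ((length (axis i) + count k i) + d))) (count-plateau k i))) ⟩
    3 + 4 * (c + (count k i + ((length (axis i) + count k i) + d))) + 1
      ≡⟨ split i 1≤i i<m ⟩
    (3 + 4 * c) + 2 * T i + (3 + 4 * d)
      ≡⟨ cong₂ (λ p q → p + 2 * T i + q) (T-count k m 2≤m ≤-refl) (T-count k (suc i) (s≤s 1≤i) i<m) ⟨
    T m + 2 * T i + T (suc i) ∎
    where
    m = span k
    2≤m = ≤-trans (s≤s (s≤s z≤n)) (4≤span k)
    c = count k m
    d = count k (suc i)
    regroup₁ : ∀ c d → 3 + 4 * (c + (1 + d)) + 1 ≡ (3 + 4 * c) + 2 + (3 + 4 * d)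
    regroup₁ = solve-∀
    regroup₂ : ∀ c d e → 3 + 4 * (c + (e + ((2 + e) + d))) + 1 ≡ (3 + 4 * c) + 2 * (3 + 4 * e) + (3 + 4 * d)
    regroup₂ = solve-∀
    split : ∀ i → 1 ≤ i → i < m →
            3 + 4 * (c + (count k i + ((length (axis i) + count k i) + d))) + 1 ≡ (3 + 4 * c) + 2 * T i + (3 + 4 * d)
    -- Here `T 1 = 1` is not of the form `3 + 4 * count`, but the copied axis has one point instead
    -- of two, and the balance is again 1.
    split 1 _ _ rewrite count-small k 1 (s≤s z≤n) = regroup₁ c d
    split i@(suc (suc _)) _ i<m rewrite T-count k i (s≤s (s≤s z≤n)) (<⇒≤ i<m) = regroup₂ c d (count k i)

  span-power : ∀ k → span k ≡ 2 ^ (2 + k)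
  span-power zero = refl
  span-power (suc k) = cong₂ _+_ (span-power k) (trans (span-power k) (sym (+-identityʳ _)))

  Mersenne : ℕ → Set
  Mersenne n = Σ ℕ λ k → n ≡ 2 ^ k ∸ 1

  -- The witness f is 2n² + n - 3 T(n), so Deficit n contains the bound 3 T(n) ≤ 2n² + n.
  Deficit : ℕ → Set
  Deficit n = Σ ℕ λ f → 3 * T n + f ≡ 2 * (n * n) + n × (f ≡ 0 → Mersenne n)

  -- When `i + 1` is the span, `T (suc i)` is known exactly, so the only unknown left is the deficit
  -- of `i`, which enters twice. The 3 cancelled on both sides is three times the `+ 1` of the
  -- recurrence.
  mersenne-step : ∀ k i f → i + 1 ≡ span k → 3 * T i + f ≡ 2 * (i * i) + i →
                  3 * T (span k + i) + 2 * f ≡ 2 * ((span k + i) * (span k + i)) + (span k + i)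
  mersenne-step k i f i+1≡m eq = +-cancelʳ-≡ 3 _ _ (begin
    3 * T (m + i) + 2 * f + 3
      ≡⟨ regroup₁ (T (m + i)) f ⟩
    3 * (T (m + i) + 1) + 2 * f
      ≡⟨ cong (λ z → 3 * z + 2 * f) (T-recurrence k i 1≤i i<m) ⟩
    3 * (T m + 2 * T i + T (suc i)) + 2 * f
      ≡⟨ cong (λ n → 3 * (T m + 2 * T i + T n) + 2 * f) (trans (+-comm 1 i) i+1≡m) ⟩
    3 * (T m + 2 * T i + T m) + 2 * f
      ≡⟨ regroup₂ (T m) (T i) f ⟩
    2 * (3 * T m) + 2 * (3 * T i + f)
      ≡⟨ cong₂ (λ p q → 2 * p + 2 * q) (T-span k) eq ⟩
    2 * (2 * (m * m) + 1) + 2 * (2 * (i * i) + i)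
      ≡⟨ cong (λ m → 2 * (2 * (m * m) + 1) + 2 * (2 * (i * i) + i)) (sym i+1≡m) ⟩
    2 * (2 * ((i + 1) * (i + 1)) + 1) + 2 * (2 * (i * i) + i)
      ≡⟨ expand i ⟩
    2 * ((i + 1 + i) * (i + 1 + i)) + (i + 1 + i) + 3
      ≡⟨ cong (λ m → 2 * ((m + i) * (m + i)) + (m + i) + 3) i+1≡m ⟩
    2 * ((m + i) * (m + i)) + (m + i) + 3 ∎)
    where
    m = span k
    1≤i : 1 ≤ i
    1≤i = ≤-trans (s≤s z≤n) (s≤s⁻¹ (≤-trans (4≤span k) (≤-reflexive (trans (sym i+1≡m) (+-comm i 1)))))
    i<m : i < m
    i<m = ≤-reflexive (trans (+-comm 1 i) i+1≡m)
    regroup₁ : ∀ t f → 3 * t + 2 * f + 3 ≡ 3 * (t + 1) + 2 * f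
    regroup₁ = solve-∀
    regroup₂ : ∀ a b f → 3 * (a + 2 * b + a) + 2 * f ≡ 2 * (3 * a) + 2 * (3 * b + f)
    regroup₂ = solve-∀
    expand : ∀ i → 2 * (2 * ((i + 1) * (i + 1)) + 1) + 2 * (2 * (i * i) + i)
                 ≡ 2 * ((i + 1 + i) * (i + 1 + i)) + (i + 1 + i) + 3
    expand = solve-∀

  -- Here j stands for m - i - 2.
  deficit-step : ∀ k i j {f g} → 1 ≤ i → i + (2 + j) ≡ span k →
    3 * T i + f ≡ 2 * (i * i) + i → 3 * T (suc i) + g ≡ 2 * (suc i * suc i) + suc i →
    3 * T (span k + i) + suc (i * (4 * j + 3) + j + 2 * f + g) ≡ 2 * ((span k + i) * (span k + i)) + (span k + i)
  deficit-step k i j {f} {g} 1≤i ij≡m eqᵢ eqⱼ = +-cancelʳ-≡ 3 _ _ (begin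
    3 * T (m + i) + suc (i * (4 * j + 3) + j + 2 * f + g) + 3
      ≡⟨ regroup₁ (T (m + i)) i j f g ⟩
    3 * (T (m + i) + 1) + suc (i * (4 * j + 3) + j + 2 * f + g)
      ≡⟨ cong (λ z → 3 * z + suc (i * (4 * j + 3) + j + 2 * f + g)) (T-recurrence k i 1≤i i<m) ⟩
    3 * (T m + 2 * T i + T (suc i)) + suc (i * (4 * j + 3) + j + 2 * f + g)
      ≡⟨ regroup₂ (T m) (T i) (T (suc i)) i j f g ⟩
    3 * T m + 2 * (3 * T i + f) + (3 * T (suc i) + g) + suc (i * (4 * j + 3) + j)
      ≡⟨ cong₂ (λ p q → p + q + suc (i * (4 * j + 3) + j)) (cong₂ (λ p q → p + 2 * q) (T-span k) eqᵢ) eqⱼ ⟩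
    2 * (m * m) + 1 + 2 * (2 * (i * i) + i) + (2 * (suc i * suc i) + suc i) + suc (i * (4 * j + 3) + j)
      ≡⟨ cong (λ m → 2 * (m * m) + 1 + 2 * (2 * (i * i) + i) + (2 * (suc i * suc i) + suc i)
                     + suc (i * (4 * j + 3) + j)) (sym ij≡m) ⟩
    2 * (n * n) + 1 + 2 * (2 * (i * i) + i) + (2 * (suc i * suc i) + suc i) + suc (i * (4 * j + 3) + j)
      ≡⟨ expand i j ⟩
    2 * ((n + i) * (n + i)) + (n + i) + 3
      ≡⟨ cong (λ m → 2 * ((m + i) * (m + i)) + (m + i) + 3) ij≡m ⟩
    2 * ((m + i) * (m + i)) + (m + i) + 3 ∎)
    where
    m = span k
    n = i + (2 + j)
    i<m : i < m
    i<m = subst (i <_) ij≡m (m<m+n i z<s)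
    regroup₁ : ∀ t i j f g → 3 * t + suc (i * (4 * j + 3) + j + 2 * f + g) + 3
                           ≡ 3 * (t + 1) + suc (i * (4 * j + 3) + j + 2 * f + g)
    regroup₁ = solve-∀
    regroup₂ : ∀ a b c i j f g → 3 * (a + 2 * b + c) + suc (i * (4 * j + 3) + j + 2 * f + g)
             ≡ 3 * a + 2 * (3 * b + f) + (3 * c + g) + suc (i * (4 * j + 3) + j)
    regroup₂ = solve-∀
    expand : ∀ i j → 2 * ((i + (2 + j)) * (i + (2 + j))) + 1 + 2 * (2 * (i * i) + i)
                     + (2 * (suc i * suc i) + suc i) + suc (i * (4 * j + 3) + j)
           ≡ 2 * ((i + (2 + j) + i) * (i + (2 + j) + i)) + (i + (2 + j) + i) + 3
    expand = solve-∀

  span-deficit : ∀ k → Deficit (span k)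
  span-deficit k = pred m , eq , λ p → contradiction (trans (sym (+-suc (width k) (width k))) p) λ ()
    where
    m = span k
    eq : 3 * T m + pred m ≡ 2 * (m * m) + m
    eq = trans (cong (_+ pred m) (T-span k)) (+-assoc (2 * (m * m)) 1 (pred m))

  -- The induction is on `k`: for `n = m + i` in the upper half, the recurrence refers only to `i`
  -- and `suc i`, both at most `m = span k` unless `i = m`, where the value is known.
  deficit : ∀ k n → 1 ≤ n → n ≤ span k → Deficit n
  deficit zero 1 _ _ = 0 , refl , λ _ → 1 , refl
  deficit zero 2 _ _ = 1 , refl , λ ()
  deficit zero 3 _ _ = 0 , refl , λ _ → 2 , refl
  deficit zero 4 _ _ = 3 , refl , λ ()
  deficit zero (suc (suc (suc (suc (suc n))))) _ (s≤s (s≤s (s≤s (s≤s ()))))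
  deficit (suc k) n 1≤n n≤2m with n ≤? span k
  ... | yes n≤m = deficit k n 1≤n n≤m
  ... | no  n≰m = subst Deficit (m+[n∸m]≡n (<⇒≤ (≰⇒> n≰m)))
                    (late (n ∸ m) (m ∸ (n ∸ m)) (m<n⇒0<n∸m (≰⇒> n≰m)) (m+[n∸m]≡n n∸m≤m))
    where
    m = span k
    n∸m≤m : n ∸ m ≤ m
    n∸m≤m = ≤-trans (∸-monoˡ-≤ m n≤2m) (≤-reflexive (m+n∸n≡m m m))
    late : ∀ i j → 1 ≤ i → i + j ≡ m → Deficit (m + i)
    late i 0 1≤i e = subst (λ i → Deficit (m + i)) (trans (sym e) (+-identityʳ i)) (span-deficit (suc k))
    -- Here `n = 2m - 1` is one less than a power of two, so the claim about a vanishing deficit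
    -- holds outright.
    late i 1 1≤i e with f , eq , _ ← deficit k i 1≤i (m+n≤o⇒m≤o i (≤-reflexive e)) =
      2 * f , mersenne-step k i f e eq , λ _ → 3 + k , mersenne
      where
      mersenne : m + i ≡ 2 ^ (3 + k) ∸ 1
      mersenne = begin
        m + i              ≡⟨ m+n∸n≡m (m + i) 1 ⟨
        m + i + 1 ∸ 1      ≡⟨ cong (_∸ 1) (trans (+-assoc m i 1) (cong (m +_) e)) ⟩
        m + m ∸ 1          ≡⟨ cong (_∸ 1) (span-power (suc k)) ⟩
        2 ^ (3 + k) ∸ 1    ∎
    -- The deficit produced here is a successor, which rules out equality.
    late i (suc (suc j)) 1≤i e
      with f , eqᵢ , _ ← deficit k i 1≤i (m+n≤o⇒m≤o i (≤-reflexive e))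
         | g , eqⱼ , _ ← deficit k (suc i) (s≤s z≤n) (subst (i <_) e (m<m+n i z<s)) =
      _ , deficit-step k i j 1≤i e eqᵢ eqⱼ , λ ()

  n≤width : ∀ n → n ≤ width n
  n≤width zero    = z≤n
  n≤width (suc n) = ≤-trans (s≤s (n≤width n)) (m≤n+m (suc (width n)) (width n))

  T-deficit : ∀ n → 1 ≤ n → Deficit n
  T-deficit n 1≤n = deficit n n 1≤n (≤-trans (n≤width n) (m≤n⇒m≤1+n (m≤m+n (width n) (suc (width n)))))

  T-bound : ∀ n → 1 ≤ n → 3 * T n ≤ 2 * (n * n) + n
  T-bound n 1≤n with f , eq , _ ← T-deficit n 1≤n = m+n≤o⇒m≤o (3 * T n) (≤-reflexive eq)

  extremal⇒mersenne : ∀ n → 1 ≤ n → 3 * T n ≡ 2 * (n * n) + n → Mersenne n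
  extremal⇒mersenne n 1≤n eq with f , eq′ , mersenne ← T-deficit n 1≤n =
    mersenne (+-cancelˡ-≡ (3 * T n) f 0 (trans eq′ (trans (sym eq) (sym (+-identityʳ (3 * T n))))))

  -- Passing from `span k - 1` to `span (suc k) - 1` doubles the deficit, and it starts at 0 because
  -- `T 3 = 7`.
  extremal-span : ∀ k i → i + 1 ≡ span k → 3 * T i ≡ 2 * (i * i) + i
  extremal-span zero 3 refl = refl
  extremal-span zero (suc (suc (suc (suc zero)))) ()
  extremal-span (suc k) n e = begin
    3 * T n            ≡⟨ cong (λ n → 3 * T n) n≡ ⟩
    3 * T (m + i)      ≡⟨ +-identityʳ _ ⟨
    3 * T (m + i) + 0  ≡⟨ mersenne-step k i 0 i+1≡m (trans (+-identityʳ _) (extremal-span k i i+1≡m)) ⟩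
    2 * ((m + i) * (m + i)) + (m + i)  ≡⟨ cong (λ n → 2 * (n * n) + n) n≡ ⟨
    2 * (n * n) + n    ∎
    where
    m = span k
    i = pred m
    i+1≡m : i + 1 ≡ m
    i+1≡m = +-comm i 1
    n≡ : n ≡ m + i
    n≡ = +-cancelʳ-≡ 1 n (m + i) (trans e (trans (cong (m +_) (sym i+1≡m)) (sym (+-assoc m i 1))))

  mersenne⇒extremal : ∀ n → 1 ≤ n → Mersenne n → 3 * T n ≡ 2 * (n * n) + n
  mersenne⇒extremal n 1≤n (0 , refl) = contradiction 1≤n λ ()
  mersenne⇒extremal n 1≤n (1 , refl) = refl
  mersenne⇒extremal n 1≤n (suc (suc k) , e) = extremal-span k n (begin
    n + 1                  ≡⟨ cong (_+ 1) e ⟩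
    2 ^ (2 + k) ∸ 1 + 1    ≡⟨ m∸n+n≡m (m^n>0 2 (2 + k)) ⟩
    2 ^ (2 + k)            ≡⟨ span-power k ⟨
    span k                 ∎)

-- Translation to rational numbers and the upper limit.

open import Data.Nat using (ℕ; suc; _*_; _^_; _∸_)
import Data.Nat as ℕ
import Data.Nat.Properties as ℕ
import Data.Nat.Tactic.RingSolver as ℕ
open import Data.Integer using (+_; +[1+_])
import Data.Integer as ℤ
import Data.Integer.Properties as ℤ
open import Data.Rational using (ℚ; mkℚ; _/_; _≤_; _+_; _-_; -_; Positive)
import Data.Rational.Properties as ℚ
open import Data.Rational.Unnormalised using (mkℚᵘ; *≡*) renaming (*≤* to *≤*ᵘ)
import Data.Rational.Unnormalised as ℚᵘ
import Data.Rational.Unnormalised.Properties as ℚᵘ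
open import Data.Product using (_×_; Σ; _,_)
open import Function.Bundles using (_⇔_; mk⇔; Equivalence)
open import Relation.Binary.PropositionalEquality
open BirthTimes using (width)
open Recurrence

-- Since `_/_` reduces to lowest terms and does not compute on variables, cross multiplication is
-- carried out on unnormalised fractions. Denominators are given by their predecessors, hence the
-- calls of `ℕ.pred` below.
/-≤ : ∀ a b c d → a * suc d ℕ.≤ c * suc b → + a / suc b ≤ + c / suc d
/-≤ a b c d le = ℚ.toℚᵘ-cancel-≤ (ℚᵘ.≤-respˡ-≃ (ℚᵘ.≃-sym (ℚ.toℚᵘ-fromℚᵘ (mkℚᵘ (+ a) b)))
  (ℚᵘ.≤-respʳ-≃ (ℚᵘ.≃-sym (ℚ.toℚᵘ-fromℚᵘ (mkℚᵘ (+ c) d)))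
    (*≤*ᵘ (subst₂ ℤ._≤_ (ℤ.pos-* a (suc d)) (ℤ.pos-* c (suc b)) (ℤ.+≤+ le)))))

/-≡ : ∀ a b c d → a * suc d ≡ c * suc b → + a / suc b ≡ + c / suc d
/-≡ a b c d eq = ℚ.fromℚᵘ-cong {mkℚᵘ (+ a) b} {mkℚᵘ (+ c) d}
  (*≡* (trans (sym (ℤ.pos-* a (suc d))) (trans (cong +_ eq) (ℤ.pos-* c (suc b)))))

/-≡⁻¹ : ∀ a b c d → + a / suc b ≡ + c / suc d → a * suc d ≡ c * suc b
/-≡⁻¹ a b c d eq with *≡* e ← ℚᵘ.≃-trans (ℚᵘ.≃-sym (ℚ.toℚᵘ-fromℚᵘ (mkℚᵘ (+ a) b)))
                                (ℚᵘ.≃-trans (ℚ.toℚᵘ-cong eq) (ℚ.toℚᵘ-fromℚᵘ (mkℚᵘ (+ c) d))) =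
  ℤ.+-injective (trans (ℤ.pos-* a (suc d)) (trans e (sym (ℤ.pos-* c (suc b)))))

/-+ : ∀ a b c d → + a / suc b + + c / suc d ≡ + (a * suc d ℕ.+ c * suc b) / (suc b * suc d)
/-+ a b c d = ℚ.toℚᵘ-injective (ℚᵘ.≃-trans (ℚ.toℚᵘ-homo-+ (+ a / suc b) (+ c / suc d))
  (ℚᵘ.≃-trans (ℚᵘ.+-cong (ℚ.toℚᵘ-fromℚᵘ (mkℚᵘ (+ a) b)) (ℚ.toℚᵘ-fromℚᵘ (mkℚᵘ (+ c) d)))
    (ℚᵘ.≃-trans (ℚᵘ.≃-reflexive (cong (λ i → mkℚᵘ i (d ℕ.+ b * suc d))
        (cong₂ ℤ._+_ (sym (ℤ.pos-* a (suc d))) (sym (ℤ.pos-* c (suc b))))))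
      (ℚᵘ.≃-sym (ℚ.toℚᵘ-fromℚᵘ (mkℚᵘ (+ (a * suc d ℕ.+ c * suc b)) (d ℕ.+ b * suc d)))))))

bound : ℕ → ℚ
bound m = + 2 / 3 + + 1 / (3 * suc m)

bound-fraction : ∀ m → let n = suc m in bound m ≡ + (2 * (n * n) ℕ.+ n) / (3 * (n * n))
bound-fraction m = trans (/-+ 2 2 1 (ℕ.pred (3 * n)))
  (/-≡ (2 * (3 * n) ℕ.+ 1 * 3) (ℕ.pred (3 * (3 * n))) (2 * (n * n) ℕ.+ n) (ℕ.pred (3 * (n * n))) (cross n))
  where
  n = suc m
  cross : ∀ n → (2 * (3 * n) ℕ.+ 1 * 3) * (3 * (n * n)) ≡ (2 * (n * n) ℕ.+ n) * (3 * (3 * n))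
  cross = ℕ.solve-∀

ratio≤bound : ∀ m → ratio (suc m) ≤ bound m
ratio≤bound m = subst (ratio n ≤_) (sym (bound-fraction m))
  (/-≤ (T n) (ℕ.pred (n * n)) (2 * (n * n) ℕ.+ n) (ℕ.pred (3 * (n * n)))
    (subst (ℕ._≤ (2 * (n * n) ℕ.+ n) * (n * n)) (shuffle (T n) n)
      (ℕ.*-monoˡ-≤ (n * n) (T-bound n (ℕ.s≤s ℕ.z≤n)))))
  where
  n = suc m
  shuffle : ∀ t n → 3 * t * (n * n) ≡ t * (3 * (n * n))
  shuffle = ℕ.solve-∀

ratio≡bound : ∀ m → ratio (suc m) ≡ bound m ⇔ Mersenne (suc m)
ratio≡bound m = mk⇔ to from
  where
  n = suc m
  shuffle : ∀ t n → 3 * t * (n * n) ≡ t * (3 * (n * n))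
  shuffle = ℕ.solve-∀
  to : ratio n ≡ bound m → Mersenne n
  to eq = extremal⇒mersenne n (ℕ.s≤s ℕ.z≤n) (ℕ.*-cancelʳ-≡ (3 * T n) (2 * (n * n) ℕ.+ n) (n * n)
    (trans (shuffle (T n) n)
      (/-≡⁻¹ (T n) (ℕ.pred (n * n)) (2 * (n * n) ℕ.+ n) (ℕ.pred (3 * (n * n))) (trans eq (bound-fraction m)))))
  from : Mersenne n → ratio n ≡ bound m
  from mersenne = trans
    (/-≡ (T n) (ℕ.pred (n * n)) (2 * (n * n) ℕ.+ n) (ℕ.pred (3 * (n * n)))
      (trans (sym (shuffle (T n) n)) (cong (_* (n * n)) (mersenne⇒extremal n (ℕ.s≤s ℕ.z≤n) mersenne))))
    (sym (bound-fraction m))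

-- The threshold is the denominator of `ε`: for `n ≥ q + 1`, `1/(3n) ≤ 1/(q+1) ≤ (p+1)/(q+1)`.
1/-small : ∀ ε → Positive ε → Σ ℕ λ N → ∀ m → N ℕ.≤ suc m → + 1 / (3 * suc m) ≤ ε
1/-small ε@(mkℚ +[1+ p ] q _) _ = suc q , λ m q<m → subst (+ 1 / (3 * suc m) ≤_) (ℚ.fromℚᵘ-toℚᵘ ε)
  (/-≤ 1 (ℕ.pred (3 * suc m)) (suc p) q
    (ℕ.≤-trans (ℕ.≤-reflexive (ℕ.*-identityˡ (suc q)))
      (ℕ.≤-trans q<m (ℕ.≤-trans (ℕ.m≤m+n (suc m) (2 * suc m)) (ℕ.m≤m+n (3 * suc m) (p * (3 * suc m)))))))

ratio-limsup : LimsupEq ratio (+ 2 / 3)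
-- Starting at `suc N` keeps `n` positive; `ratio 0` is only a default value.
ratio-limsup ε ε>0 with N , small ← 1/-small ε ε>0 = (suc N , upper) , lower
  where
  instance _ = ε>0
  upper : ∀ n → suc N ℕ.≤ n → ratio n ≤ + 2 / 3 + ε
  upper (suc m) N<n = ℚ.≤-trans (ratio≤bound m) (ℚ.+-monoʳ-≤ (+ 2 / 3) (small m (ℕ.<⇒≤ N<n)))
  lower : ∀ M → Σ ℕ λ n → M ℕ.≤ n × + 2 / 3 - ε ≤ ratio n
  lower M = suc m , M≤n , ℚ.≤-trans (ℚ.+-monoʳ-≤ (+ 2 / 3) -ε≤)
                            (ℚ.≤-reflexive (sym (Equivalence.from (ratio≡bound m) (2 ℕ.+ M , mersenne))))
    where
    -- Thus `suc m` is `span M - 1 = 2 ^ (2 + M) - 1`, a number past `M` at which the bound is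
    -- attained; there `ratio` equals `2/3 + 1/(3n)`.
    m = width M ℕ.+ width M
    M≤n : M ℕ.≤ suc m
    M≤n = ℕ.≤-trans (n≤width M) (ℕ.m≤n⇒m≤1+n (ℕ.m≤m+n (width M) (width M)))
    mersenne : suc m ≡ 2 ^ (2 ℕ.+ M) ∸ 1
    mersenne = trans (sym (ℕ.+-suc (width M) (width M))) (cong (_∸ 1) (span-power M))
    -ε≤ : - ε ≤ + 1 / (3 * suc m)
    -ε≤ = ℚ.≤-trans (ℚ.neg-antimono-≤ (ℚ.<⇒≤ (ℚ.positive⁻¹ ε))) (/-≤ 0 0 1 (ℕ.pred (3 * suc m)) ℕ.z≤n)

theorem4 : ((m : ℕ) →
    (ratio (suc m) ≤ (+ 2 / 3) + (+ 1 / (3 * suc m)))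
    × (ratio (suc m) ≡ (+ 2 / 3) + (+ 1 / (3 * suc m)) ⇔ Σ ℕ (λ k → suc m ≡ 2 ^ k ∸ 1)))
  × LimsupEq ratio (+ 2 / 3)
theorem4 = (λ m → ratio≤bound m , ratio≡bound m) , ratio-limsup
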